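{- Define integers $s_n(i,j),t_n(i,j)$ ($n\ge1$, $i,j\in\mathbb Z$) by $t_1(0,1)=1$, $t_1(i,j)=0$ for $(i,j)\ne(0,1)$, and for $n\ge1$ $$s_n(i,j)=i\,t_n(i,j-1)+j\,t_n(i-1,j)+2(3n+2-i-2j)t_n(i-1,j-1),$$ $$t_{n+1}(i,j)=(i+1)s_n(i+1,j-1)+j\,s_n(i,j)+2(3n+3-i-2j)s_n(i,j-1).$$ Then for $n\ge1$, $$s_n(i,j)=\#\{\pi\in\mathrm{JSP}_n:\mathrm{ubdes}(\pi)=i,\ \mathrm{expk}(\pi)=j,\ \mathrm{bddes}(\pi)=0,\ \mathrm{desp}(\pi)=0\},$$ $$t_n(i,j)=\#\{\pi\in\mathrm{JSPD}_n:\mathrm{ubdes}(\pi)=i,\ \mathrm{expk}(\pi)=j,\ \mathrm{bddes}(\pi)=0,\ \mathrm{desp}(\pi)=0\}.$$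
   Context: $M_n=\{\overline1,1,1,\overline2,2,2,\dots,\overline n,n,n\}$ with total order $\overline1<1<\overline2<2<\cdots<\overline n<n$. For a sub-multiset $M$ of $M_n$, a Jacobi-Stirling permutation of $M$ is a permutation of $M$ such that for each $i$ whose two unbarred copies lie in $M$, all entries between them are larger than $i$. $\mathrm{JSP}_n$ is the set of Jacobi-Stirling permutations of $M_n$ and $\mathrm{JSPD}_n$ that of $M_n\setminus\{n,n\}$. For such $\pi=\pi_1\cdots\pi_m$ set $\pi_0=\pi_{m+1}=0$; all statistics below range over indices $i\in[m]$: $\mathrm{ubdes}(\pi)=\#\{i:\pi_i>\pi_{i+1},\ \pi_i\text{ unbarred}\}$; $\mathrm{expk}(\pi)=\#\{i:\pi_{i-1}<\pi_i>\pi_{i+1}\text{ or }\pi_{i-1}<\pi_i=\pi_{i+1}\}$; $\mathrm{bddes}(\pi)=\#\{i:\pi_{i-1}>\pi_i>\pi_{i+1},\ \pi_i\text{ barred}\}$; $\mathrm{desp}(\pi)=\#\{i:\pi_{i-1}>\pi_i=\pi_{i+1}\}$. -}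

module Defs where

open import Data.Nat as ℕ using (ℕ; zero; suc; _∸_; _%_; _<ᵇ_; _≡ᵇ_)
open import Data.Integer as ℤ using (ℤ; +_; -[1+_])
open import Data.Bool using (Bool; true; false; _∧_; _∨_; if_then_else_)
open import Data.List using (List; []; _∷_; _++_; [_]; length; lookup)
open import Data.Fin as Fin using (Fin)
open import Data.Product using (_×_; ∃)
open import Relation.Binary.PropositionalEquality using (_≡_)
open import Data.List.Relation.Binary.Permutation.Propositional using (_↭_)

-- Encoding of letters of M_n as positive naturals:
--   barred k  ↦ 2k-1,   unbarred k ↦ 2k   (k ≥ 1).
-- Then  1̄ < 1 < 2̄ < 2 < ... is exactly the usual order on ℕ,
-- and the sentinel π₀ = π_{m+1} = 0 is smaller than every letter.

barred : ℕ → ℕ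
barred k = 2 ℕ.* k ∸ 1

unbarred : ℕ → ℕ
unbarred k = 2 ℕ.* k

isBarred : ℕ → Bool
isBarred x = x % 2 ≡ᵇ 1

isUnbarred : ℕ → Bool
isUnbarred x = x % 2 ≡ᵇ 0

M : ℕ → List ℕ
M zero    = []
M (suc n) = M n ++ (barred (suc n) ∷ unbarred (suc n) ∷ unbarred (suc n) ∷ [])

MD : ℕ → List ℕ
MD zero    = []
MD (suc n) = M n ++ [ barred (suc n) ]

JSCond : List ℕ → Set
JSCond π = (p q r : Fin (length π)) → p Fin.< r → r Fin.< q →
           lookup π p ≡ lookup π q → isUnbarred (lookup π p) ≡ true →
           lookup π p ℕ.< lookup π r

JSP : ℕ → List ℕ → Set
JSP n π = (π ↭ M n) × JSCond π

JSPD : ℕ → List ℕ → Set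
JSPD n π = (π ↭ MD n) × JSCond π

windows : (ℕ → ℕ → ℕ → Bool) → List ℕ → ℕ
windows P (a ∷ b ∷ c ∷ rest) =
  (if P a b c then 1 else 0) ℕ.+ windows P (b ∷ c ∷ rest)
windows P _ = 0

countPos : (ℕ → ℕ → ℕ → Bool) → List ℕ → ℕ
countPos P π = windows P (0 ∷ (π ++ [ 0 ]))

ubdes : List ℕ → ℕ
ubdes = countPos (λ a b c → (c <ᵇ b) ∧ isUnbarred b)

expk : List ℕ → ℕ
expk = countPos (λ a b c → ((a <ᵇ b) ∧ (c <ᵇ b)) ∨ ((a <ᵇ b) ∧ (b ≡ᵇ c)))

bddes : List ℕ → ℕ
bddes = countPos (λ a b c → (b <ᵇ a) ∧ (c <ᵇ b) ∧ isBarred b)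

desp : List ℕ → ℕ
desp = countPos (λ a b c → (b <ᵇ a) ∧ (b ≡ᵇ c))

-- The integers s_n(i,j), t_n(i,j).  Only n ≥ 1 is meaningful;
-- s 0 and t 0 are junk values (0).

t₁ : ℤ → ℤ → ℤ
t₁ (+ 0) (+ 1) = + 1
t₁ _ _ = + 0

mutual
  s : ℕ → ℤ → ℤ → ℤ
  s zero i j = + 0
  s (suc m) i j =
    let n = suc m in
    i ℤ.* t n i (j ℤ.- + 1)
    ℤ.+ j ℤ.* t n (i ℤ.- + 1) j
    ℤ.+ + 2 ℤ.* (+ (3 ℕ.* n ℕ.+ 2) ℤ.- i ℤ.- + 2 ℤ.* j) ℤ.* t n (i ℤ.- + 1) (j ℤ.- + 1)

  t : ℕ → ℤ → ℤ → ℤ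
  t zero i j = + 0
  t (suc zero) i j = t₁ i j
  t (suc (suc m)) i j =
    let n = suc m in
    (i ℤ.+ + 1) ℤ.* s n (i ℤ.+ + 1) (j ℤ.- + 1)
    ℤ.+ j ℤ.* s n i j
    ℤ.+ + 2 ℤ.* (+ (3 ℕ.* n ℕ.+ 3) ℤ.- i ℤ.- + 2 ℤ.* j) ℤ.* s n i (j ℤ.- + 1)

{-# OPTIONS --safe #-}
module Submission where

-- A letter b of a word (padded by 0 on both sides) has a type determined by its two neighbours; ubdes, expk and
-- bddes + desp count the letters of type U, E and K, and A counts the double ascents.  Charge every gap of the word
-- to its right letter if the gap is an ascent, to its left letter otherwise.  Inserting a new maximal block into a gap
-- charged to a letter changes the type of that letter only: E becomes K (left gap) or A (right gap), while U, K and A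
-- become Z and Z owns no gap.  So insertion acts on generating functions as the derivation E → K + A, U, K, A → 1,
-- times the weight of the new letters.  This derivation maps K and A to the same thing and produces only K + A from E,
-- so the generating functions are polynomials in U, E and K + A, and the derivation becomes E → v, v → 2, U → 1 with
-- v = K + A.  Setting K = 0 extracts the words with bddes = desp = 0, the exponent of v is the number of gaps
-- minus i + 2j, and comparing coefficients gives the recurrences for s and t.

open import Defs
open import Data.Bool using (Bool; true; false; not; T; _∧_; _∨_; if_then_else_)
open import Data.Bool.Properties using (T-≡)
open import Data.Fin as Fin using (zero; suc)
open import Data.Nat as ℕ using (ℕ; zero; suc; _≤_; _<_; _<?_; _<ᵇ_; _≡ᵇ_; z≤n; s≤s)
import Data.Nat.Properties as ℕ
open import Data.Nat.DivMod using (m%n<n; m*n%n≡0; [m+kn]%n≡m%n)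
import Data.Nat.Tactic.RingSolver as ℕ-Ring
open import Data.Integer as ℤ using (ℤ; +_; -[1+_]; _+_; _*_; _-_)
import Data.Integer.Properties as ℤ
open import Data.Integer.Tactic.RingSolver using (solve-∀)
open import Data.List using (List; []; _∷_; _++_; [_]; length; lookup; map; concatMap; filter)
open import Data.List.Properties
  using (++-assoc; ++-identityʳ; length-++; filter-++; filter-all; filter-none; ∷-injectiveˡ; ∷-injectiveʳ)
open import Data.List.Relation.Unary.All as All using (All; []; _∷_)
import Data.List.Relation.Unary.All.Properties as All
open import Data.List.Relation.Unary.Any using (here; there; index)
open import Data.List.Relation.Unary.Any.Properties using (lookup-index)
open import Data.List.Relation.Unary.AllPairs using ([]; _∷_)
open import Data.List.Relation.Unary.Unique.Propositional using (Unique)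
import Data.List.Relation.Unary.Unique.Propositional.Properties as Unique
open import Data.List.Membership.Propositional using (_∈_; _∉_; find; lose)
open import Data.List.Membership.Propositional.Properties
  using (∈-map⁺; ∈-map⁻; ∈-++⁺ˡ; ∈-++⁺ʳ; ∈-++⁻; ∈-∃++; ∈-insert; ∈-lookup;
         ∈-concatMap⁺; ∈-concatMap⁻; ∈-filter⁺; ∈-filter⁻)
open import Data.List.Relation.Binary.Permutation.Propositional using (_↭_; ↭-refl; ↭-sym; ↭-trans; ↭-reflexive)
open import Data.List.Relation.Binary.Permutation.Propositional.Properties
  using (All-resp-↭; ∈-resp-↭; ↭-length; drop-mid; shifts; ↭-empty-inv)
  renaming (++⁺ˡ to ↭-++⁺ˡ; ++-comm to ↭-++-comm)
open import Data.Product using (Σ; _×_; _,_; proj₁; proj₂; ∃₂)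
open import Data.Sum using (_⊎_; inj₁; inj₂)
open import Data.Unit using (⊤; tt)
open import Function.Bundles using (_⇔_; mk⇔; Equivalence)
open import Relation.Binary using (tri<; tri≈; tri>)
open import Relation.Binary.PropositionalEquality hiding ([_])
open import Relation.Nullary using (¬_; Dec; yes; no; contradiction)
open import Relation.Nullary.Decidable using (_×-dec_)

-- Weights and the insertion derivation

-- f u e k a is the value of f on the monomial Uᵘ Eᵉ Kᵏ Aᵃ; a generating function is the functional that sums f over
-- words, so sh, D and d below are transposes of multiplication by a letter and of the derivation of the introduction.
Weight : Set
Weight = ℕ → ℕ → ℕ → ℕ → ℤ

data Type : Set where
  U E K A Z : Type

δ : Type → Type → ℕ
δ U U = 1
δ E E = 1
δ K K = 1
δ A A = 1
δ _ _ = 0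

sh : Type → Weight → Weight
sh x f u e k a = f (δ U x ℕ.+ u) (δ E x ℕ.+ e) (δ K x ℕ.+ k) (δ A x ℕ.+ a)

-- The transpose of d/dx: `∂ g n` is the value of `g` on the derivative of xⁿ.
∂ : (ℕ → ℤ) → ℕ → ℤ
∂ g zero    = + 0
∂ g (suc n) = + suc n * g n

∂-suc : ∀ (g : ℕ → ℤ) n → ∂ g (suc n) ≡ g n + ∂ (λ m → g (suc m)) n
∂-suc g zero    = trans (ℤ.*-identityˡ (g 0)) (sym (ℤ.+-identityʳ (g 0)))
∂-suc g (suc n) = ℤ.suc-* (+ suc n) (g (suc n))

∂-cong : ∀ {g h : ℕ → ℤ} → (∀ n → g n ≡ h n) → ∀ n → ∂ g n ≡ ∂ h n
∂-cong eq zero    = refl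
∂-cong eq (suc n) = cong (λ x → + suc n * x) (eq n)

∂-+ : ∀ (g h : ℕ → ℤ) n → ∂ (λ m → g m + h m) n ≡ ∂ g n + ∂ h n
∂-+ g h zero    = refl
∂-+ g h (suc n) = ℤ.*-distribˡ-+ (+ suc n) (g n) (h n)

-- Differentiating and multiplying back by the variable is the Euler operator x d/dx, which is
-- diagonal on monomials.
∂-∘suc : ∀ (g : ℕ → ℤ) n → ∂ (λ m → g (suc m)) n ≡ + n * g n
∂-∘suc g zero    = refl
∂-∘suc g (suc n) = refl

∂e ∂k ∂a ∂u D : Weight → Weight
∂e f u e k a = ∂ (λ e′ → f u e′ (suc k) a + f u e′ k (suc a)) e
∂k f u e k a = ∂ (λ k′ → f u e k′ a) k
∂a f u e k a = ∂ (λ a′ → f u e k a′) a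
∂u f u e k a = ∂ (λ u′ → f u′ e k a) u
D f u e k a = ∂e f u e k a + ∂k f u e k a + ∂a f u e k a + ∂u f u e k a

d : Type → Weight → Weight
d E f u e k a = f u e (suc k) a + f u e k (suc a)
d Z f u e k a = + 0
d _ f = f

private
  pull₁ : ∀ x p q r s → x + p + q + r + s ≡ x + (p + q + r + s)
  pull₁ = solve-∀
  pull₂ : ∀ x p q r s → p + (x + q) + r + s ≡ x + (p + q + r + s)
  pull₂ = solve-∀
  pull₃ : ∀ x p q r s → p + q + (x + r) + s ≡ x + (p + q + r + s)
  pull₃ = solve-∀
  pull₄ : ∀ x p q r s → p + q + r + (x + s) ≡ x + (p + q + r + s)
  pull₄ = solve-∀

-- The product rule for a letter times a monomial. Only the partial derivative in the variable of
-- `x` changes, and `∂-suc` supplies its extra term.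
sh-D : ∀ x f u e k a → sh x (D f) u e k a ≡ d x f u e k a + D (sh x f) u e k a
sh-D U f u e k a
  rewrite ∂-suc (λ u′ → f u′ e k a) u
  = pull₄ (f u e k a) (∂e g u e k a) (∂k g u e k a) (∂a g u e k a) (∂u g u e k a)
  where g = sh U f
sh-D E f u e k a
  rewrite ∂-suc (λ e′ → f u e′ (suc k) a + f u e′ k (suc a)) e
  = pull₁ (f u e (suc k) a + f u e k (suc a)) (∂e g u e k a) (∂k g u e k a) (∂a g u e k a) (∂u g u e k a)
  where g = sh E f
sh-D K f u e k a
  rewrite ∂-suc (λ k′ → f u e k′ a) k
  = pull₂ (f u e k a) (∂e g u e k a) (∂k g u e k a) (∂a g u e k a) (∂u g u e k a)
  where g = sh K f
sh-D A f u e k a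
  rewrite ∂-suc (λ a′ → f u e k a′) a
  = pull₃ (f u e k a) (∂e g u e k a) (∂k g u e k a) (∂a g u e k a) (∂u g u e k a)
  where g = sh A f
sh-D Z f u e k a = sym (ℤ.+-identityˡ _)

-- Restriction to polynomials in U, E and K + A

Weight₃ : Set
Weight₃ = ℕ → ℕ → ℕ → ℤ

-- P f u e m is the value of f on Uᵘ Eᵉ (K + A)ᵐ.
P : Weight → Weight₃
P f u e zero    = f u e 0 0
P f u e (suc m) = P (sh K f) u e m + P (sh A f) u e m

P-cong : ∀ {f g : Weight} → (∀ u e k a → f u e k a ≡ g u e k a) → ∀ u e m → P f u e m ≡ P g u e m
P-cong eq u e zero    = eq u e 0 0
P-cong eq u e (suc m) =
  cong₂ _+_ (P-cong (λ u e k a → eq u e (suc k) a) u e m)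
            (P-cong (λ u e k a → eq u e k (suc a)) u e m)

private
  swap : ∀ p q r s → p + q + (r + s) ≡ p + r + (q + s)
  swap = solve-∀

P-+ : ∀ f g u e m → P (λ u e k a → f u e k a + g u e k a) u e m ≡ P f u e m + P g u e m
P-+ f g u e zero    = refl
P-+ f g u e (suc m)
  rewrite P-+ (sh K f) (sh K g) u e m | P-+ (sh A f) (sh A g) u e m
  = swap (P (sh K f) u e m) (P (sh K g) u e m) (P (sh A f) u e m) (P (sh A g) u e m)

∂e₃ ∂m₃ ∂u₃ D₃ : Weight₃ → Weight₃
∂e₃ g u e m = ∂ (λ e′ → g u e′ (suc m)) e
∂m₃ g u e m = ∂ (λ m′ → g u e m′ + g u e m′) m
∂u₃ g u e m = ∂ (λ u′ → g u′ e m) u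
D₃ g u e m = ∂e₃ g u e m + ∂m₃ g u e m + ∂u₃ g u e m

D₃-cong : ∀ {g h : Weight₃} → (∀ u e m → g u e m ≡ h u e m) → ∀ u e m → D₃ g u e m ≡ D₃ h u e m
D₃-cong eq u e m =
  cong₂ _+_ (cong₂ _+_ (∂-cong (λ e′ → eq u e′ (suc m)) e)
                       (∂-cong (λ m′ → cong₂ _+_ (eq u e m′) (eq u e m′)) m))
            (∂-cong (λ u′ → eq u′ e m) u)

private
  gather : ∀ x p p′ q q′ r r′ →
    (x + (p + q + r)) + (x + (p′ + q′ + r′)) ≡ (p + p′) + (x + x + (q + q′)) + (r + r′)
  gather = solve-∀

-- K and A both go to 1, so K + A goes to 2, and E goes to K + A: the polynomials in U, E and K + A
-- are preserved. In the induction the product rules for K and for A each leave one `P f u e m`;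
-- together they are the doubled term of `∂m₃`.
P-D : ∀ f u e m → P (D f) u e m ≡ D₃ (P f) u e m
P-D f u e zero = cong (_+ ∂ (λ u′ → f u′ e 0 0) u) (ℤ.+-identityʳ (x + + 0))
  where x = ∂e f u e 0 0
P-D f u e (suc m)
  rewrite P-cong (sh-D K f) u e m | P-cong (sh-D A f) u e m
        | P-+ f (D (sh K f)) u e m | P-+ f (D (sh A f)) u e m
        | P-D (sh K f) u e m | P-D (sh A f) u e m
        | ∂-+ (λ e′ → P (sh K f) u e′ (suc m)) (λ e′ → P (sh A f) u e′ (suc m)) e
        | ∂-+ (λ u′ → P (sh K f) u′ e m) (λ u′ → P (sh A f) u′ e m) u
        | ∂-suc (λ m′ → P f u e m′ + P f u e m′) m
        | ∂-cong {λ m′ → P f u e (suc m′) + P f u e (suc m′)}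
                 (λ m′ → swap (P (sh K f) u e m′) (P (sh A f) u e m′)
                           (P (sh K f) u e m′) (P (sh A f) u e m′)) m
        | ∂-+ (λ m′ → P (sh K f) u e m′ + P (sh K f) u e m′) (λ m′ → P (sh A f) u e m′ + P (sh A f) u e m′) m
  = gather (P f u e m) (∂e₃ pK u e m) (∂e₃ pA u e m) (∂m₃ pK u e m) (∂m₃ pA u e m)
           (∂u₃ pK u e m) (∂u₃ pA u e m)
  where
  pK pA : Weight₃
  pK = P (sh K f)
  pA = P (sh A f)

-- The substitution K = 0, with the exponent of A then read as that of v = K + A.
res : Weight₃ → Weight
res g u e zero    a = g u e a
res g u e (suc k) a = + 0

res-cong : ∀ {g h : Weight₃} → (∀ u e m → g u e m ≡ h u e m) → ∀ u e k a → res g u e k a ≡ res h u e k a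
res-cong eq u e zero    a = eq u e a
res-cong eq u e (suc k) a = refl

P-0 : ∀ u e m → P (λ _ _ _ _ → + 0) u e m ≡ + 0
P-0 u e zero = refl
P-0 u e (suc m) rewrite P-0 u e m = refl

-- Of the terms of (K + A)ᵐ only Aᵐ survives K = 0.
P-res : ∀ g u e m → P (res g) u e m ≡ g u e m
P-res g u e zero    = refl
P-res g u e (suc m) = begin
  P (sh K (res g)) u e m + P (sh A (res g)) u e m
    ≡⟨ cong₂ _+_ (P-0 u e m) (P-cong shA-res u e m) ⟩
  + 0 + P (res (λ u e m → g u e (suc m))) u e m
    ≡⟨ ℤ.+-identityˡ _ ⟩
  P (res (λ u e m → g u e (suc m))) u e m
    ≡⟨ P-res _ u e m ⟩
  g u e (suc m) ∎
  where
  open ≡-Reasoning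
  shA-res : ∀ u e k a → sh A (res g) u e k a ≡ res (λ u e m → g u e (suc m)) u e k a
  shA-res u e zero    a = refl
  shA-res u e (suc k) a = refl

-- Letter types and insertion of a maximal block

T⇒≡ : ∀ {b} → T b → b ≡ true
T⇒≡ {true} _ = refl

<⇒<ᵇ≡true : ∀ {a b} → a < b → (a <ᵇ b) ≡ true
<⇒<ᵇ≡true a<b = T⇒≡ (ℕ.<⇒<ᵇ a<b)

≤⇒<ᵇ≡false : ∀ {a b} → b ≤ a → (a <ᵇ b) ≡ false
≤⇒<ᵇ≡false {a} {b} b≤a with a <ᵇ b in eq
... | false = refl
... | true  = contradiction (ℕ.<ᵇ⇒< a b (Equivalence.from T-≡ eq)) (ℕ.≤⇒≯ b≤a)

≡ᵇ-refl : ∀ a → (a ≡ᵇ a) ≡ true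
≡ᵇ-refl a = T⇒≡ (ℕ.≡⇒≡ᵇ a a refl)

≢⇒≡ᵇ≡false : ∀ {a b} → a ≢ b → (a ≡ᵇ b) ≡ false
≢⇒≡ᵇ≡false {a} {b} a≢b with a ≡ᵇ b in eq
... | false = refl
... | true  = contradiction (ℕ.≡ᵇ⇒≡ a b (Equivalence.from T-≡ eq)) a≢b

isBarred≡not : ∀ x → isBarred x ≡ not (isUnbarred x)
isBarred≡not x with x ℕ.% 2 | m%n<n x 2
... | 0 | _ = refl
... | 1 | _ = refl
... | suc (suc _) | s≤s (s≤s ())

-- The left neighbour matters only through `a < b` or `b ≤ a`, so an inserted maximum may stand in
-- for any left neighbour that is at least b. In a Jacobi-Stirling word the first letter of a
-- plateau has type E or K, the second U or Z.
type : ℕ → ℕ → ℕ → Type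
type a b c =
  if a <ᵇ b then (if b <ᵇ c then A else E)
  else if b <ᵇ c then Z
  else if (b ≡ᵇ c) ∨ isBarred b then K
  else U

types : List ℕ → List Type
types (a ∷ b ∷ c ∷ l) = type a b c ∷ types (b ∷ c ∷ l)
types _ = []

# : Type → List Type → ℕ
# x []       = 0
# x (y ∷ ys) = δ x y ℕ.+ # x ys

ev : List Type → Weight → ℤ
ev ts f = f (# U ts) (# E ts) (# K ts) (# A ts)

-- The Leibniz expansion of D, one summand per letter.
dv : List Type → Weight → ℤ
dv []       f = + 0
dv (x ∷ xs) f = ev xs (d x f) + dv xs (sh x f)

dv≡ev-D : ∀ ts f → dv ts f ≡ ev ts (D f)
dv≡ev-D []       f = refl
dv≡ev-D (x ∷ xs) f =
  trans (cong (λ z → ev xs (d x f) + z) (dv≡ev-D xs (sh x f)))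
        (sym (sh-D x f (# U xs) (# E xs) (# K xs) (# A xs)))

data Kind : Set where
  bar pair : Kind

block : Kind → ℕ → List ℕ
block bar  m = m ∷ []
block pair m = m ∷ m ∷ []

Fits : Kind → ℕ → Set
Fits bar  m = isUnbarred m ≡ false
Fits pair m = isUnbarred m ≡ true

-- Between smaller neighbours a single maximum has type E; of two equal copies the first has type E
-- and the second type U.
β : Kind → Weight → Weight
β bar  f = sh E f
β pair f = sh U (sh E f)

β-sh : ∀ κ x f → β κ (sh x f) ≡ sh x (β κ f)
β-sh bar  U f = refl
β-sh bar  E f = refl
β-sh bar  K f = refl
β-sh bar  A f = refl
β-sh bar  Z f = refl
β-sh pair U f = refl
β-sh pair E f = refl
β-sh pair K f = refl
β-sh pair A f = refl
β-sh pair Z f = refl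

-- What the type of b needs to know about a Jacobi-Stirling word: an unbarred peak would have a smaller letter between
-- it and its other copy.  These local conditions, unlike JSCond, visibly survive the insertion of a maximal block.
record Local (a b c : ℕ) : Set where
  field
    peak⇒barred   : a < b → c < b → isUnbarred b ≡ false
    barred⇒single : isUnbarred b ≡ false → a ≢ b
    no-triple     : a ≡ b → b ≢ c
open Local

data Locals : List ℕ → Set where
  one  : ∀ {a} → Locals (a ∷ [])
  two  : ∀ {a b} → Locals (a ∷ b ∷ [])
  _∷_ : ∀ {a b c l} → Local a b c → Locals (b ∷ c ∷ l) → Locals (a ∷ b ∷ c ∷ l)

module _ {a b c : ℕ} where
  type-A : a < b → b < c → type a b c ≡ A
  type-A p q rewrite <⇒<ᵇ≡true p | <⇒<ᵇ≡true q = refl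

  type-E : a < b → c ≤ b → type a b c ≡ E
  type-E p q rewrite <⇒<ᵇ≡true p | ≤⇒<ᵇ≡false q = refl

  type-Z : b ≤ a → b < c → type a b c ≡ Z
  type-Z p q rewrite ≤⇒<ᵇ≡false p | <⇒<ᵇ≡true q = refl

  type-K-plateau : b ≤ a → b ≡ c → type a b c ≡ K
  type-K-plateau p refl rewrite ≤⇒<ᵇ≡false p | ≤⇒<ᵇ≡false (ℕ.≤-refl {b}) | ≡ᵇ-refl b = refl

  type-K-barred : b ≤ a → c < b → isUnbarred b ≡ false → type a b c ≡ K
  type-K-barred p q r
    rewrite ≤⇒<ᵇ≡false p | ≤⇒<ᵇ≡false (ℕ.<⇒≤ q) | ≢⇒≡ᵇ≡false (ℕ.>⇒≢ q) | isBarred≡not b | r = refl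

  type-U : b ≤ a → c < b → isUnbarred b ≡ true → type a b c ≡ U
  type-U p q r
    rewrite ≤⇒<ᵇ≡false p | ≤⇒<ᵇ≡false (ℕ.<⇒≤ q) | ≢⇒≡ᵇ≡false (ℕ.>⇒≢ q) | isBarred≡not b | r = refl

type-replaceˡ : ∀ {a a′ b c} → b ≤ a → b ≤ a′ → type a b c ≡ type a′ b c
type-replaceˡ p q rewrite ≤⇒<ᵇ≡false p | ≤⇒<ᵇ≡false q = refl

types-replaceˡ : ∀ {a a′ b} l → b ≤ a → b ≤ a′ → types (a ∷ b ∷ l) ≡ types (a′ ∷ b ∷ l)
types-replaceˡ []      p q = refl
types-replaceˡ {b = b} (c ∷ l) p q = cong (_∷ types (b ∷ c ∷ l)) (type-replaceˡ {c = c} p q)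

-- Summation over all insertions of a block

inserts : List ℕ → List ℕ → List (List ℕ)
inserts B []      = B ∷ []
inserts B (x ∷ l) = (B ++ x ∷ l) ∷ map (x ∷_) (inserts B l)

∑ : {X : Set} → List X → (X → ℤ) → ℤ
∑ []       f = + 0
∑ (x ∷ xs) f = f x + ∑ xs f

∑-map : {X Y : Set} (g : X → Y) (f : Y → ℤ) (xs : List X) → ∑ (map g xs) f ≡ ∑ xs (λ x → f (g x))
∑-map g f []       = refl
∑-map g f (x ∷ xs) = cong (λ z → f (g x) + z) (∑-map g f xs)

∑-++ : {X : Set} (f : X → ℤ) (xs ys : List X) → ∑ (xs ++ ys) f ≡ ∑ xs f + ∑ ys f
∑-++ f []       ys = sym (ℤ.+-identityˡ _)
∑-++ f (x ∷ xs) ys = trans (cong (λ z → f x + z) (∑-++ f xs ys)) (sym (ℤ.+-assoc (f x) _ _))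

∑-concatMap : {X Y : Set} (g : X → List Y) (f : Y → ℤ) (xs : List X) →
              ∑ (concatMap g xs) f ≡ ∑ xs (λ x → ∑ (g x) f)
∑-concatMap g f []       = refl
∑-concatMap g f (x ∷ xs) =
  trans (∑-++ f (g x) (concatMap g xs)) (cong (λ z → ∑ (g x) f + z) (∑-concatMap g f xs))

∑-cong : {X : Set} {f g : X → ℤ} (xs : List X) → (∀ {x} → x ∈ xs → f x ≡ g x) → ∑ xs f ≡ ∑ xs g
∑-cong []       eq = refl
∑-cong (x ∷ xs) eq = cong₂ _+_ (eq (here refl)) (∑-cong xs (λ x∈ → eq (there x∈)))

ev-after : ∀ κ {m} a b l f →
           ev (types (a ∷ b ∷ block κ m ++ l)) f ≡ ev (types (b ∷ block κ m ++ l)) (sh (type a b m) f)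
ev-after bar  a b l f = refl
ev-after pair a b l f = refl

ev-block : ∀ κ {m x c} l f → Fits κ m → x < m → c < m →
           ev (types (x ∷ block κ m ++ c ∷ l)) f ≡ ev (types (m ∷ c ∷ l)) (β κ f)
ev-block bar  l f _ x<m c<m rewrite type-E x<m (ℕ.<⇒≤ c<m) = refl
ev-block pair {m} l f u x<m c<m rewrite type-E x<m (ℕ.≤-refl {m}) | type-U (ℕ.≤-refl {m}) c<m u = refl

module Insertion (κ : Kind) (m : ℕ) (fits : Fits κ m) where

  B : List ℕ
  B = block κ m

  -- The gap between a and b is charged to b if it is an ascent and to a otherwise.
  ascent : ℕ → ℕ → List ℕ → Weight → ℤ
  ascent a b l f = if a <ᵇ b then ev (types (a ∷ B ++ b ∷ l)) f else + 0

  ascent-< : ∀ {a b} l f → a < b → ascent a b l f ≡ ev (types (a ∷ B ++ b ∷ l)) f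
  ascent-< l f a<b rewrite <⇒<ᵇ≡true a<b = refl

  ascent-≥ : ∀ {a b} l f → b ≤ a → ascent a b l f ≡ + 0
  ascent-≥ l f b≤a rewrite ≤⇒<ᵇ≡false b≤a = refl

  -- The gap after b is charged to b only if `c ≤ b`; if `b < c`, its contribution is passed on to c
  -- as `ascent b c`. What remains with b is its own summand of the Leibniz expansion, so these
  -- equations telescope along the word.
  around : ∀ {a b c} l f → Local a b c → a < m → b < m → c < m →
           ascent a b (c ∷ l) f + ev (types (a ∷ b ∷ B ++ c ∷ l)) f
         ≡ ev (types (b ∷ c ∷ l)) (d (type a b c) (β κ f)) + ascent b c l (sh (type a b c) f)
  around {a} {b} {c} l f loc a<m b<m c<m = go (ℕ.<-≤-connex a b) (ℕ.<-≤-connex b c)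
    where
    open ≡-Reasoning
    X : List Type
    X = types (b ∷ c ∷ l)

    before : ∀ {x} → a < b → type m b c ≡ x → ascent a b (c ∷ l) f ≡ ev X (sh x (β κ f))
    before a<b eq = trans (ascent-< (c ∷ l) f a<b) (trans (ev-block κ (c ∷ l) f fits a<m b<m)
                      (cong (λ x → ev X (sh x (β κ f))) eq))

    after-< : ∀ {x} → b < c → type a b m ≡ x →
              ev (types (a ∷ b ∷ B ++ c ∷ l)) f ≡ ascent b c l (sh x f)
    after-< {x} b<c eq = trans (ev-after κ a b (c ∷ l) f)
      (trans (cong (λ x → ev (types (b ∷ B ++ c ∷ l)) (sh x f)) eq) (sym (ascent-< l (sh x f) b<c)))

    after-≥ : ∀ {x} → c ≤ b → type a b m ≡ x →
              ev (types (a ∷ b ∷ B ++ c ∷ l)) f ≡ ev X (sh x (β κ f))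
    after-≥ {x} c≤b eq = begin
      ev (types (a ∷ b ∷ B ++ c ∷ l)) f           ≡⟨ ev-after κ a b (c ∷ l) f ⟩
      ev (types (b ∷ B ++ c ∷ l)) (sh (type a b m) f) ≡⟨ cong (λ x → ev (types (b ∷ B ++ c ∷ l)) (sh x f)) eq ⟩
      ev (types (b ∷ B ++ c ∷ l)) (sh x f)        ≡⟨ ev-block κ l (sh x f) fits b<m c<m ⟩
      ev (types (m ∷ c ∷ l)) (β κ (sh x f))       ≡⟨ cong (λ ts → ev ts (β κ (sh x f)))
                                                       (types-replaceˡ l (ℕ.<⇒≤ c<m) c≤b) ⟩
      ev X (β κ (sh x f))                         ≡⟨ cong (ev X) (β-sh κ x f) ⟩
      ev X (sh x (β κ f))                         ∎

    -- Only the types U and K occur here, and the derivation sends both to 1.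
    descent-d : c ≤ b → b ≤ a → ∀ g → ev X (d (type a b c) g) ≡ ev X g
    descent-d c≤b b≤a g with ℕ.m≤n⇒m<n∨m≡n c≤b | isUnbarred b in u
    ... | inj₂ refl | _     rewrite type-K-plateau {c = b} b≤a refl = refl
    ... | inj₁ c<b  | false rewrite type-K-barred b≤a c<b u = refl
    ... | inj₁ c<b  | true  rewrite type-U b≤a c<b u = refl

    -- Behind m, the former peak starts a plateau or is a double descent; in the second case
    -- `peak⇒barred` rules out type U.
    peak-K : a < b → c ≤ b → type m b c ≡ K
    peak-K a<b c≤b with ℕ.m≤n⇒m<n∨m≡n c≤b
    ... | inj₂ refl = type-K-plateau (ℕ.<⇒≤ b<m) refl
    ... | inj₁ c<b  = type-K-barred (ℕ.<⇒≤ b<m) c<b (peak⇒barred loc a<b c<b)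

    Goal : Type → Set
    Goal x = ascent a b (c ∷ l) f + ev (types (a ∷ b ∷ B ++ c ∷ l)) f
           ≡ ev X (d x (β κ f)) + ascent b c l (sh x f)

    go : a < b ⊎ b ≤ a → b < c ⊎ c ≤ b → Goal (type a b c)
    go (inj₁ a<b) (inj₁ b<c) = subst Goal (sym (type-A a<b b<c))
      (cong₂ _+_ (before a<b (type-Z (ℕ.<⇒≤ b<m) b<c)) (after-< b<c (type-A a<b b<m)))
    go (inj₁ a<b) (inj₂ c≤b) = subst Goal (sym (type-E a<b c≤b))
      (trans (cong₂ _+_ (before a<b (peak-K a<b c≤b)) (after-≥ c≤b (type-A a<b b<m)))
             (trans (sym (ℤ.+-identityʳ (ev X (d E (β κ f)))))
                    (cong (λ z → ev X (d E (β κ f)) + z) (sym (ascent-≥ l (sh E f) c≤b)))))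
    go (inj₂ b≤a) (inj₁ b<c) = subst Goal (sym (type-Z b≤a b<c))
      (cong₂ _+_ (ascent-≥ (c ∷ l) f b≤a) (after-< b<c (type-Z b≤a b<m)))
    go (inj₂ b≤a) (inj₂ c≤b) = begin
      ascent a b (c ∷ l) f + y        ≡⟨ cong (λ z → z + y) (ascent-≥ (c ∷ l) f b≤a) ⟩
      + 0 + y                         ≡⟨ ℤ.+-comm (+ 0) y ⟩
      y + + 0                         ≡⟨ cong₂ _+_ (after-≥ c≤b (type-Z b≤a b<m))
                                                   (sym (ascent-≥ l (sh (type a b c) f) c≤b)) ⟩
      ev X (β κ f) + h                ≡⟨ cong (λ z → z + h) (descent-d c≤b b≤a (β κ f)) ⟨
      ev X (d (type a b c) (β κ f)) + h ∎
      where
      y = ev (types (a ∷ b ∷ B ++ c ∷ l)) f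
      h = ascent b c l (sh (type a b c) f)

  Gaps : ℕ → ℕ → List ℕ → Weight → ℤ
  Gaps a b l f = ∑ (inserts B l) (λ ρ → ev (types (a ∷ b ∷ ρ ++ [ 0 ])) f)

  -- Generalised to suffixes for the induction: the sum covers the gaps after b, and the `ascent`
  -- term adds the gap before b when it is charged to b.
  gaps : ∀ {a b} l f → Locals (a ∷ b ∷ l ++ [ 0 ]) → a < m → b < m → All (_< m) l →
         ascent a b (l ++ [ 0 ]) f + Gaps a b l f ≡ dv (types (a ∷ b ∷ l ++ [ 0 ])) (β κ f)
  gaps {a} {b} [] f (loc ∷ _) a<m b<m [] = begin
    p + (q + + 0)                               ≡⟨ cong (λ z → p + z) (ℤ.+-identityʳ q) ⟩
    p + q                                       ≡⟨ around [] f loc a<m b<m 0<m ⟩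
    -- The sentinel 0 makes the last gap no ascent, so nothing is passed on.
    r + ascent b 0 [] (sh (type a b 0) f)       ≡⟨ cong (λ z → r + z) (ascent-≥ {b} [] (sh (type a b 0) f) z≤n) ⟩
    r + + 0                                     ∎
    where
    open ≡-Reasoning
    0<m = ℕ.≤-<-trans z≤n a<m
    p = ascent a b [ 0 ] f
    q = ev (types (a ∷ b ∷ B ++ [ 0 ])) f
    r = ev [] (d (type a b 0) (β κ f))
  gaps {a} {b} (c ∷ l) f (loc ∷ locs) a<m b<m (c<m ∷ l<m) = begin
    p + (ev (types (a ∷ b ∷ (B ++ c ∷ l) ++ [ 0 ])) f + s′)
      ≡⟨ cong₂ (λ L z → p + (ev (types (a ∷ b ∷ L)) f + z)) (++-assoc B (c ∷ l) [ 0 ]) (∑-map (c ∷_) _ (inserts B l)) ⟩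
    p + (q + w)
      ≡⟨ ℤ.+-assoc p q w ⟨
    p + q + w
      ≡⟨ cong (λ z → z + w) (around (l ++ [ 0 ]) f loc a<m b<m c<m) ⟩
    r + h + w
      ≡⟨ ℤ.+-assoc r h w ⟩
    r + (h + w)
      ≡⟨ cong (λ z → r + z) (trans (gaps l (sh (type a b c) f) locs b<m c<m l<m)
                                     (cong (dv (types (b ∷ c ∷ l ++ [ 0 ]))) (β-sh κ (type a b c) f))) ⟩
    r + dv (types (b ∷ c ∷ l ++ [ 0 ])) (sh (type a b c) (β κ f)) ∎
    where
    open ≡-Reasoning
    p = ascent a b (c ∷ l ++ [ 0 ]) f
    q = ev (types (a ∷ b ∷ B ++ c ∷ l ++ [ 0 ])) f
    r = ev (types (b ∷ c ∷ l ++ [ 0 ])) (d (type a b c) (β κ f))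
    h = ascent b c (l ++ [ 0 ]) (sh (type a b c) f)
    w = Gaps b c l (sh (type a b c) f)
    s′ = ∑ (map (c ∷_) (inserts B l)) (λ ρ → ev (types (a ∷ b ∷ ρ ++ [ 0 ])) f)

  -- As `0 < x`, the first gap is an ascent, so the `ascent` term of `gaps` is the insertion at the
  -- front.
  inserts-sum : ∀ {x} l f → Locals (0 ∷ x ∷ l ++ [ 0 ]) → 0 < x → All (_< m) (x ∷ l) →
                ∑ (inserts B (x ∷ l)) (λ ρ → ev (types (0 ∷ ρ ++ [ 0 ])) f)
              ≡ dv (types (0 ∷ x ∷ l ++ [ 0 ])) (β κ f)
  inserts-sum {x} l f locs 0<x (x<m ∷ l<m)
    rewrite ++-assoc B (x ∷ l) [ 0 ] | ∑-map (x ∷_) (λ ρ → ev (types (0 ∷ ρ ++ [ 0 ])) f) (inserts B l)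
          | sym (ascent-< (l ++ [ 0 ]) f 0<x) =
    gaps l f locs (ℕ.<-trans 0<x x<m) x<m l<m

-- Statistics and degrees of words

Local-replaceʳ : ∀ {a b c m} → b < m → Local a b c → Local a b m
Local-replaceʳ b<m loc .peak⇒barred a<b m<b = contradiction m<b (ℕ.<-asym b<m)
Local-replaceʳ b<m loc .barred⇒single       = barred⇒single loc
Local-replaceʳ b<m loc .no-triple _         = ℕ.<⇒≢ b<m

Local-max : ∀ {m b c} → c < m → Local m c b
Local-max c<m .peak⇒barred m<c _  = contradiction m<c (ℕ.<-asym c<m)
Local-max c<m .barred⇒single _    = ℕ.>⇒≢ c<m
Local-max c<m .no-triple m≡c      = contradiction m≡c (ℕ.>⇒≢ c<m)

Locals-replaceˡ : ∀ {m b c} l → c < m → Locals (b ∷ c ∷ l) → Locals (m ∷ c ∷ l)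
Locals-replaceˡ []      c<m two          = two
Locals-replaceˡ (_ ∷ _) c<m (_ ∷ locs) = Local-max c<m ∷ locs

-- A single m is a peak and has to be barred. The copies in a pair are neighbours, so neither is a
-- strict peak, and being unbarred they may be equal.
Locals-block : ∀ κ {m b c} l → Fits κ m → b < m → c < m →
               Locals (b ∷ c ∷ l) → Locals (b ∷ block κ m ++ c ∷ l)
Locals-block bar l fits b<m c<m locs = record
  { peak⇒barred   = λ _ _ → fits
  ; barred⇒single = λ _ → ℕ.<⇒≢ b<m
  ; no-triple     = λ b≡m → contradiction b≡m (ℕ.<⇒≢ b<m)
  } ∷ Locals-replaceˡ l c<m locs
Locals-block pair l fits b<m c<m locs = record
  { peak⇒barred   = λ _ m<m → contradiction m<m (ℕ.<-irrefl refl)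
  ; barred⇒single = λ _ → ℕ.<⇒≢ b<m
  ; no-triple     = λ b≡m → contradiction b≡m (ℕ.<⇒≢ b<m)
  } ∷ record
  { peak⇒barred   = λ m<m → contradiction m<m (ℕ.<-irrefl refl)
  ; barred⇒single = λ barred → contradiction (trans (sym fits) barred) λ ()
  ; no-triple     = λ _ → ℕ.>⇒≢ c<m
  } ∷ Locals-replaceˡ l c<m locs

Locals-around : ∀ κ {m a b c} l → Fits κ m → b < m → c < m →
                Locals (a ∷ b ∷ c ∷ l) → Locals (a ∷ b ∷ block κ m ++ c ∷ l)
Locals-around bar  l fits b<m c<m (loc ∷ locs) = Local-replaceʳ b<m loc ∷ Locals-block bar l fits b<m c<m locs
Locals-around pair l fits b<m c<m (loc ∷ locs) = Local-replaceʳ b<m loc ∷ Locals-block pair l fits b<m c<m locs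

module _ (κ : Kind) {m : ℕ} (fits : Fits κ m) where

  Locals-inserts : ∀ {a b ρ} l → b < m → All (_< m) l → Locals (a ∷ b ∷ l ++ [ 0 ]) →
                   ρ ∈ inserts (block κ m) l → Locals (a ∷ b ∷ ρ ++ [ 0 ])
  Locals-inserts [] b<m [] locs (here refl) =
    Locals-around κ [] fits b<m (ℕ.≤-<-trans z≤n b<m) locs
  Locals-inserts (c ∷ l) b<m (c<m ∷ l<m) locs (here refl)
    rewrite ++-assoc (block κ m) (c ∷ l) [ 0 ] = Locals-around κ (l ++ [ 0 ]) fits b<m c<m locs
  Locals-inserts (c ∷ l) b<m (c<m ∷ l<m) (loc ∷ locs) (there ρ∈)
    with ρ′ , ρ′∈ , refl ← ∈-map⁻ (c ∷_) ρ∈ = loc ∷ Locals-inserts l c<m l<m locs ρ′∈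

  Locals-inserts₀ : ∀ {x l ρ} → All (_< m) (x ∷ l) → Locals (0 ∷ x ∷ l ++ [ 0 ]) →
                    ρ ∈ inserts (block κ m) (x ∷ l) → Locals (0 ∷ ρ ++ [ 0 ])
  Locals-inserts₀ {x} {l} (x<m ∷ l<m) locs (here refl)
    rewrite ++-assoc (block κ m) (x ∷ l) [ 0 ] =
    Locals-block κ (l ++ [ 0 ]) fits (ℕ.≤-<-trans z≤n x<m) x<m locs
  Locals-inserts₀ {x} {l} (x<m ∷ l<m) locs (there ρ∈)
    with ρ′ , ρ′∈ , refl ← ∈-map⁻ (x ∷_) ρ∈ = Locals-inserts l x<m l<m locs ρ′∈

toℕ : Bool → ℕ
toℕ b = if b then 1 else 0

-- Repeated from the definitions of the four statistics, so that `windows` of these on a padded word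
-- is definitionally the statistic.
is-ubdes is-expk is-bddes is-desp : ℕ → ℕ → ℕ → Bool
is-ubdes a b c = (c <ᵇ b) ∧ isUnbarred b
is-expk  a b c = ((a <ᵇ b) ∧ (c <ᵇ b)) ∨ ((a <ᵇ b) ∧ (b ≡ᵇ c))
is-bddes a b c = (b <ᵇ a) ∧ (c <ᵇ b) ∧ isBarred b
is-desp  a b c = (b <ᵇ a) ∧ (b ≡ᵇ c)

module _ {a b c : ℕ} (loc : Local a b c) where
  -- `peak⇒barred` handles unbarred peaks, which `ubdes` would count although their type is E.
  -- `barred⇒single` and `no-triple` exclude letters of type K with `a ≡ b`, which the strict
  -- comparisons in `bddes` and `desp` would miss.
  δ-type : δ U (type a b c) ≡ toℕ (is-ubdes a b c)
         × δ E (type a b c) ≡ toℕ (is-expk a b c)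
         × δ K (type a b c) ≡ toℕ (is-bddes a b c) ℕ.+ toℕ (is-desp a b c)
  δ-type with ℕ.<-cmp a b | ℕ.<-cmp b c
  ... | tri< p _ _ | tri< q r _
    rewrite <⇒<ᵇ≡true p | ≤⇒<ᵇ≡false (ℕ.<⇒≤ p) | <⇒<ᵇ≡true q | ≤⇒<ᵇ≡false (ℕ.<⇒≤ q) | ≢⇒≡ᵇ≡false r
    = refl , refl , refl
  ... | tri< p _ _ | tri≈ _ refl _
    rewrite <⇒<ᵇ≡true p | ≤⇒<ᵇ≡false (ℕ.<⇒≤ p) | ≤⇒<ᵇ≡false (ℕ.≤-refl {b}) | ≡ᵇ-refl b
    = refl , refl , refl
  ... | tri< p _ _ | tri> _ _ q
    rewrite <⇒<ᵇ≡true p | ≤⇒<ᵇ≡false (ℕ.<⇒≤ p) | <⇒<ᵇ≡true q | ≤⇒<ᵇ≡false (ℕ.<⇒≤ q)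
          | peak⇒barred loc p q
    = refl , refl , refl
  ... | tri≈ _ refl _ | tri< q _ _
    rewrite ≤⇒<ᵇ≡false (ℕ.≤-refl {b}) | <⇒<ᵇ≡true q | ≤⇒<ᵇ≡false (ℕ.<⇒≤ q)
    = refl , refl , refl
  ... | tri≈ _ refl _ | tri≈ _ b≡c _ = contradiction b≡c (no-triple loc refl)
  ... | tri≈ _ refl _ | tri> _ r q
    with isUnbarred b in u
  ... | false = contradiction refl (barred⇒single loc u)
  ... | true
    rewrite ≤⇒<ᵇ≡false (ℕ.≤-refl {b}) | <⇒<ᵇ≡true q | ≤⇒<ᵇ≡false (ℕ.<⇒≤ q) | ≢⇒≡ᵇ≡false r
          | isBarred≡not b | u
    = refl , refl , refl
  δ-type | tri> _ _ p | tri< q r _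
    rewrite <⇒<ᵇ≡true p | ≤⇒<ᵇ≡false (ℕ.<⇒≤ p) | <⇒<ᵇ≡true q | ≤⇒<ᵇ≡false (ℕ.<⇒≤ q) | ≢⇒≡ᵇ≡false r
    = refl , refl , refl
  δ-type | tri> _ _ p | tri≈ _ refl _
    rewrite <⇒<ᵇ≡true p | ≤⇒<ᵇ≡false (ℕ.<⇒≤ p) | ≤⇒<ᵇ≡false (ℕ.≤-refl {b}) | ≡ᵇ-refl b
    = refl , refl , refl
  δ-type | tri> _ _ p | tri> _ r q
    rewrite <⇒<ᵇ≡true p | ≤⇒<ᵇ≡false (ℕ.<⇒≤ p) | <⇒<ᵇ≡true q | ≤⇒<ᵇ≡false (ℕ.<⇒≤ q) | ≢⇒≡ᵇ≡false r
          | isBarred≡not b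
    with isUnbarred b
  ... | true  = refl , refl , refl
  ... | false = refl , refl , refl

private
  interchange : ∀ a b x y → a ℕ.+ b ℕ.+ (x ℕ.+ y) ≡ a ℕ.+ x ℕ.+ (b ℕ.+ y)
  interchange = ℕ-Ring.solve-∀

#-types : ∀ {l} → Locals l →
          # U (types l) ≡ windows is-ubdes l
        × # E (types l) ≡ windows is-expk l
        × # K (types l) ≡ windows is-bddes l ℕ.+ windows is-desp l
#-types one = refl , refl , refl
#-types two = refl , refl , refl
#-types {a ∷ b ∷ c ∷ l} (loc ∷ locs) with u , e , k ← δ-type loc | u′ , e′ , k′ ← #-types locs =
  cong₂ ℕ._+_ u u′ , cong₂ ℕ._+_ e e′ ,
  trans (cong₂ ℕ._+_ k k′) (interchange (toℕ (is-bddes a b c)) (toℕ (is-desp a b c)) _ _)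

-- The number of gaps charged to a letter of the given type.
owned : Type → ℕ
owned E = 2
owned Z = 0
owned _ = 1

-- b owns its left gap if `a < b` and its right gap unless `b < c`. Written without subtraction, the
-- identity telescopes.
owned-type : ∀ a b c → owned (type a b c) ℕ.+ toℕ (b <ᵇ c) ≡ suc (toℕ (a <ᵇ b))
owned-type a b c with a <ᵇ b | b <ᵇ c | (b ≡ᵇ c) ∨ isBarred b
... | true  | true  | _ = refl
... | true  | false | _ = refl
... | false | true  | _ = refl
... | false | false | true = refl
... | false | false | false = refl

-- The total number of owned gaps. It is fixed by the length of the word, so it determines the count
-- of A from the other three.
degree : List Type → ℕ
degree ts = # U ts ℕ.+ 2 ℕ.* # E ts ℕ.+ # K ts ℕ.+ # A ts

degree-∷ : ∀ x ts → degree (x ∷ ts) ≡ owned x ℕ.+ degree ts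
degree-∷ x ts = lemma x (# U ts) (# E ts) (# K ts) (# A ts)
  where
  e₁ : ∀ u e k a → u ℕ.+ 2 ℕ.* suc e ℕ.+ k ℕ.+ a ≡ 2 ℕ.+ (u ℕ.+ 2 ℕ.* e ℕ.+ k ℕ.+ a)
  e₁ = ℕ-Ring.solve-∀
  k₁ : ∀ u e k a → u ℕ.+ 2 ℕ.* e ℕ.+ suc k ℕ.+ a ≡ 1 ℕ.+ (u ℕ.+ 2 ℕ.* e ℕ.+ k ℕ.+ a)
  k₁ = ℕ-Ring.solve-∀
  lemma : ∀ x u e k a → (δ U x ℕ.+ u) ℕ.+ 2 ℕ.* (δ E x ℕ.+ e) ℕ.+ (δ K x ℕ.+ k) ℕ.+ (δ A x ℕ.+ a)
                      ≡ owned x ℕ.+ (u ℕ.+ 2 ℕ.* e ℕ.+ k ℕ.+ a)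
  lemma U u e k a = refl
  lemma E u e k a = e₁ u e k a
  lemma K u e k a = k₁ u e k a
  lemma A u e k a = ℕ.+-suc (u ℕ.+ 2 ℕ.* e ℕ.+ k) a
  lemma Z u e k a = refl

degree-types : ∀ a b l → degree (types (a ∷ b ∷ l ++ [ 0 ])) ≡ toℕ (a <ᵇ b) ℕ.+ suc (length l)
degree-types a b [] = begin
  degree (type a b 0 ∷ [])    ≡⟨ degree-∷ (type a b 0) [] ⟩
  owned (type a b 0) ℕ.+ 0    ≡⟨ owned-type a b 0 ⟩
  suc (toℕ (a <ᵇ b))          ≡⟨ ℕ.+-comm 1 _ ⟩
  toℕ (a <ᵇ b) ℕ.+ 1          ∎
  where open ≡-Reasoning
degree-types a b (c ∷ l) = begin
  degree (type a b c ∷ types (b ∷ c ∷ l ++ [ 0 ]))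
    ≡⟨ degree-∷ (type a b c) (types (b ∷ c ∷ l ++ [ 0 ])) ⟩
  owned (type a b c) ℕ.+ degree (types (b ∷ c ∷ l ++ [ 0 ]))
    ≡⟨ cong (owned (type a b c) ℕ.+_) (degree-types b c l) ⟩
  owned (type a b c) ℕ.+ (toℕ (b <ᵇ c) ℕ.+ suc (length l))
    ≡⟨ ℕ.+-assoc (owned (type a b c)) _ _ ⟨
  owned (type a b c) ℕ.+ toℕ (b <ᵇ c) ℕ.+ suc (length l)
    ≡⟨ cong (ℕ._+ suc (length l)) (owned-type a b c) ⟩
  suc (toℕ (a <ᵇ b)) ℕ.+ suc (length l)
    ≡⟨ ℕ.+-suc (toℕ (a <ᵇ b)) (suc (length l)) ⟨
  toℕ (a <ᵇ b) ℕ.+ suc (length (c ∷ l)) ∎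
  where open ≡-Reasoning

-- Enumeration of Jacobi-Stirling permutations

-- An index-free form of what `JSCond` asks of an unbarred `x` in front of the list, suited to
-- induction over insertions and deletions.
Separated : ℕ → List ℕ → Set
Separated x []      = ⊤
Separated x (y ∷ l) = (x ∈ l → x < y) × Separated x l

JS : List ℕ → Set
JS []      = ⊤
JS (x ∷ l) = (isUnbarred x ≡ true → Separated x l) × JS l

Separated⁺ : ∀ {x} l → (∀ r q → r Fin.< q → lookup l q ≡ x → x < lookup l r) → Separated x l
Separated⁺ []      h = tt
Separated⁺ (y ∷ l) h =
  (λ x∈l → h zero (suc (index x∈l)) (s≤s z≤n) (sym (lookup-index x∈l))) ,
  Separated⁺ l (λ r q r<q → h (suc r) (suc q) (s≤s r<q))

Separated⁻ : ∀ {x} l → Separated x l → ∀ r q → r Fin.< q → lookup l q ≡ x → x < lookup l r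
Separated⁻ (y ∷ l) (h , _) zero    (suc q) _         eq = h (subst (_∈ l) eq (∈-lookup q))
Separated⁻ (y ∷ l) (_ , s) (suc r) (suc q) (s≤s r<q) eq = Separated⁻ l s r q r<q eq

JSCond⇒JS : ∀ l → JSCond l → JS l
JSCond⇒JS []      c = tt
JSCond⇒JS (x ∷ l) c =
  (λ u → Separated⁺ l (λ r q r<q eq → c zero (suc q) (suc r) (s≤s z≤n) (s≤s r<q) (sym eq) u)) ,
  JSCond⇒JS l (λ p q r p<r r<q → c (suc p) (suc q) (suc r) (s≤s p<r) (s≤s r<q))

JS⇒JSCond : ∀ l → JS l → JSCond l
JS⇒JSCond (x ∷ l) (s , js) zero    (suc q) (suc r) _         (s≤s r<q) eq u = Separated⁻ l (s u) r q r<q (sym eq)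
JS⇒JSCond (x ∷ l) (s , js) (suc p) (suc q) (suc r) (s≤s p<r) (s≤s r<q) eq u = JS⇒JSCond l js p q r p<r r<q eq u

∈-++-weaken : ∀ {x : ℕ} xs B {ys} → x ∈ xs ++ ys → x ∈ xs ++ B ++ ys
∈-++-weaken xs B x∈ with ∈-++⁻ xs x∈
... | inj₁ p = ∈-++⁺ˡ p
... | inj₂ p = ∈-++⁺ʳ xs (∈-++⁺ʳ B p)

Separated-remove : ∀ {x} xs B {ys} → Separated x (xs ++ B ++ ys) → Separated x (xs ++ ys)
Separated-remove []       []      s       = s
Separated-remove []       (_ ∷ B) (_ , s) = Separated-remove [] B s
Separated-remove (y ∷ xs) B       (h , s) = (λ x∈ → h (∈-++-weaken xs B x∈)) , Separated-remove xs B s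

JS-remove : ∀ xs B {ys} → JS (xs ++ B ++ ys) → JS (xs ++ ys)
JS-remove []       []      js       = js
JS-remove []       (_ ∷ B) (_ , js) = JS-remove [] B js
JS-remove (x ∷ xs) B       (s , js) = (λ u → Separated-remove xs B (s u)) , JS-remove xs B js

<⇒∉ : ∀ {m l} → All (_< m) l → m ∉ l
<⇒∉ l<m m∈l = ℕ.<-irrefl refl (All.lookup l<m m∈l)

∈-block : ∀ κ {m x} → x ∈ block κ m → x ≡ m
∈-block bar  (here eq)         = eq
∈-block pair (here eq)         = eq
∈-block pair (there (here eq)) = eq

Separated-max : ∀ {m l} → All (_< m) l → Separated m l
Separated-max []          = tt
Separated-max (_ ∷ l<m) = (λ m∈l → contradiction m∈l (<⇒∉ l<m)) , Separated-max l<m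

module _ (κ : Kind) {m : ℕ} where

  ∈-++-strengthen : ∀ {x} xs {ys} → x < m → x ∈ xs ++ block κ m ++ ys → x ∈ xs ++ ys
  ∈-++-strengthen xs x<m x∈ with ∈-++⁻ xs x∈
  ... | inj₁ p = ∈-++⁺ˡ p
  ... | inj₂ p with ∈-++⁻ (block κ m) p
  ... | inj₁ q = contradiction (∈-block κ q) (ℕ.<⇒≢ x<m)
  ... | inj₂ q = ∈-++⁺ʳ xs q

Separated-insert : ∀ κ {m x} xs {ys} → x < m → Separated x (xs ++ ys) → Separated x (xs ++ block κ m ++ ys)
Separated-insert bar  []       x<m s       = (λ _ → x<m) , s
Separated-insert pair []       x<m s       = (λ _ → x<m) , (λ _ → x<m) , s
Separated-insert κ    (y ∷ xs) x<m (h , s) =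
  (λ x∈ → h (∈-++-strengthen κ xs x<m x∈)) , Separated-insert κ xs x<m s

JS-insert : ∀ κ {m} xs {ys} → Fits κ m → All (_< m) (xs ++ ys) → JS (xs ++ ys) → JS (xs ++ block κ m ++ ys)
JS-insert bar  []       fits l<m js = (λ u → contradiction (trans (sym fits) u) λ ()) , js
JS-insert pair []       fits l<m js =
  (λ _ → (λ m∈ → contradiction m∈ (<⇒∉ l<m)) , Separated-max l<m) , (λ _ → Separated-max l<m) , js
JS-insert κ    (x ∷ xs) fits (x<m ∷ l<m) (s , js) =
  (λ u → Separated-insert κ xs x<m (s u)) , JS-insert κ xs fits l<m js

inserts⁺ : ∀ B xs ys → xs ++ B ++ ys ∈ inserts B (xs ++ ys)
inserts⁺ B []       []       = here (++-identityʳ B)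
inserts⁺ B []       (y ∷ ys) = here refl
inserts⁺ B (x ∷ xs) ys       = there (∈-map⁺ (x ∷_) (inserts⁺ B xs ys))

inserts⁻ : ∀ B {ρ} l → ρ ∈ inserts B l → ∃₂ λ xs ys → l ≡ xs ++ ys × ρ ≡ xs ++ B ++ ys
inserts⁻ B []      (here refl) = [] , [] , refl , sym (++-identityʳ B)
inserts⁻ B (x ∷ l) (here refl) = [] , x ∷ l , refl , refl
inserts⁻ B (x ∷ l) (there ρ∈)
  with ρ′ , ρ′∈ , refl ← ∈-map⁻ (x ∷_) ρ∈
  with xs , ys , refl , refl ← inserts⁻ B l ρ′∈ = x ∷ xs , ys , refl , refl

-- A letter z right after the first m with another m still to come would satisfy `m < z`, against
-- maximality; so the copies are adjacent.
maximal-pair : ∀ {m} xs zs → isUnbarred m ≡ true → All (_≤ m) (xs ++ m ∷ zs) → m ∈ zs → JS (xs ++ m ∷ zs) →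
               ∃₂ λ xs′ ys → xs ++ m ∷ zs ≡ xs′ ++ m ∷ m ∷ ys
maximal-pair {m} [] (z ∷ zs) u (_ ∷ z≤m ∷ _) m∈ (s , _) = [] , zs , cong (λ y → m ∷ y ∷ zs) (z≡m m∈)
  where
  z≡m : m ∈ z ∷ zs → z ≡ m
  z≡m (here refl) = refl
  z≡m (there m∈zs) = contradiction z≤m (ℕ.<⇒≱ (proj₁ (s u) m∈zs))
maximal-pair (x ∷ xs) zs u (_ ∷ l≤m) m∈ (_ , js)
  with xs′ , ys , eq ← maximal-pair xs zs u l≤m m∈ js = x ∷ xs′ , ys , cong (x ∷_) eq

maximal-twice : ∀ {m} xs ys → isUnbarred m ≡ true → All (_≤ m) (xs ++ m ∷ ys) → JS (xs ++ m ∷ ys) →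
                m ∈ xs ⊎ m ∈ ys → ∃₂ λ xs′ ys′ → xs ++ m ∷ ys ≡ xs′ ++ m ∷ m ∷ ys′
maximal-twice xs ys u l≤m js (inj₂ m∈ys) = maximal-pair xs ys u l≤m m∈ys js
maximal-twice {m} xs ys u l≤m js (inj₁ m∈xs) with x₁ , x₂ , refl ← ∈-∃++ m∈xs
  rewrite ++-assoc x₁ (m ∷ x₂) (m ∷ ys) =
  maximal-pair x₁ (x₂ ++ m ∷ ys) u l≤m (∈-insert x₂) js

-- The inverse of insertion: the copies of the maximum form one block, trivially for a bar and by
-- `maximal-twice` for a pair.
split-max : ∀ κ {m R ρ} → Fits κ m → All (_< m) R → ρ ↭ block κ m ++ R → JS ρ →
            ∃₂ λ xs ys → ρ ≡ xs ++ block κ m ++ ys × xs ++ ys ↭ R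
split-max bar fits R<m ρ↭ js
  with xs , ys , refl ← ∈-∃++ (∈-resp-↭ (↭-sym ρ↭) (here refl)) = xs , ys , refl , drop-mid xs [] ρ↭
split-max pair {m} {R} {ρ} fits R<m ρ↭ js
  with xs , ys , refl ← ∈-∃++ (∈-resp-↭ (↭-sym ρ↭) (here refl)) =
  let xs′ , ys′ , eq = maximal-twice xs ys fits ρ≤m js
                         (∈-++⁻ xs (∈-resp-↭ (↭-sym (drop-mid xs [] ρ↭)) (here refl)))
  in  xs′ , ys′ , eq , drop-mid xs′ [] (drop-mid xs′ [] (subst (_↭ m ∷ m ∷ R) eq ρ↭))
  where
  ρ≤m : All (_≤ m) ρ
  ρ≤m = All-resp-↭ (↭-sym ρ↭) (ℕ.≤-refl ∷ ℕ.≤-refl ∷ All.map ℕ.<⇒≤ R<m)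

extend : Kind → ℕ → List (List ℕ) → List (List ℕ)
extend κ m = concatMap (inserts (block κ m))

Enumerates : List (List ℕ) → List ℕ → Set
Enumerates W R = ∀ π → π ∈ W ⇔ (π ↭ R × JS π)

module _ (κ : Kind) {m : ℕ} where

  extend⁻ : ∀ {ρ} W → ρ ∈ extend κ m W → ∃₂ λ xs ys → (xs ++ ys) ∈ W × ρ ≡ xs ++ block κ m ++ ys
  extend⁻ W ρ∈
    with π , π∈ , ρ∈π ← find (∈-concatMap⁻ (inserts (block κ m)) {W} ρ∈)
    with xs , ys , refl , eq ← inserts⁻ (block κ m) π ρ∈π = xs , ys , π∈ , eq

  extend-Enumerates : ∀ {R R′ W} → Fits κ m → All (_< m) R → R′ ↭ block κ m ++ R →
                      Enumerates W R → Enumerates (extend κ m W) R′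
  extend-Enumerates {R} {R′} {W} fits R<m R′↭ enum ρ = mk⇔ to from
    where
    to : ρ ∈ extend κ m W → ρ ↭ R′ × JS ρ
    to ρ∈
      with xs , ys , π∈ , refl ← extend⁻ W ρ∈
      with π↭ , js ← Equivalence.to (enum (xs ++ ys)) π∈ =
      ↭-trans (shifts xs (block κ m)) (↭-trans (↭-++⁺ˡ (block κ m) π↭) (↭-sym R′↭)) ,
      JS-insert κ xs fits (All-resp-↭ (↭-sym π↭) R<m) js
    from : ρ ↭ R′ × JS ρ → ρ ∈ extend κ m W
    from (ρ↭ , js)
      with xs , ys , refl , π↭ ← split-max κ fits R<m (↭-trans ρ↭ R′↭) js =
      ∈-concatMap⁺ (inserts (block κ m))
        (lose (Equivalence.from (enum (xs ++ ys)) (π↭ , JS-remove xs (block κ m) js))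
              (inserts⁺ (block κ m) xs ys))

  block-none : All (λ x → ¬ x < m) (block κ m)
  block-none = All.tabulate λ x∈ → ℕ.≤⇒≯ (ℕ.≤-reflexive (sym (∈-block κ x∈)))

  -- Discarding the maximum recovers the original word, so distinct words have disjoint sets of
  -- extensions.
  filter-insert : ∀ xs ys → All (_< m) (xs ++ ys) → filter (_<? m) (xs ++ block κ m ++ ys) ≡ xs ++ ys
  filter-insert xs ys l<m
    rewrite filter-++ (_<? m) xs (block κ m ++ ys) | filter-++ (_<? m) (block κ m) ys
          | filter-none (_<? m) block-none
          | filter-all (_<? m) (All.++⁻ˡ xs l<m) | filter-all (_<? m) (All.++⁻ʳ xs l<m) = refl

  block-head : ∀ {x l l′} → block κ m ++ l ≡ x ∷ l′ → m ≡ x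
  block-head = go κ
    where
    go : ∀ κ {x l l′} → block κ m ++ l ≡ x ∷ l′ → m ≡ x
    go bar  = ∷-injectiveˡ
    go pair = ∷-injectiveˡ

  -- Insertion at the front yields first letter m; every other insertion keeps the first letter
  -- `x < m`.
  inserts-unique : ∀ {l} → All (_< m) l → Unique (inserts (block κ m) l)
  inserts-unique []          = [] ∷ []
  inserts-unique {x ∷ l} (x<m ∷ l<m) =
    All.tabulate (λ v∈ eq → let _ , _ , v≡ = ∈-map⁻ (x ∷_) v∈
                            in  ℕ.>⇒≢ x<m (block-head (trans eq v≡)))
    ∷ Unique.map⁺ ∷-injectiveʳ (inserts-unique l<m)

  extend-unique : ∀ {W} → All (All (_< m)) W → Unique W → Unique (extend κ m W)
  extend-unique [] [] = []
  extend-unique {π ∷ W} (π<m ∷ W<m) (π∉W ∷ W!) =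
    Unique.++⁺ (inserts-unique π<m) (extend-unique W<m W!) disjoint
    where
    disjoint : ∀ {ρ} → ¬ (ρ ∈ inserts (block κ m) π × ρ ∈ extend κ m W)
    disjoint (p , q)
      with xs , ys , refl , refl ← inserts⁻ (block κ m) π p
      with xs′ , ys′ , π′∈ , eq ← extend⁻ W q =
      All.lookup π∉W π′∈ (begin
        xs ++ ys                                  ≡⟨ filter-insert xs ys π<m ⟨
        filter (_<? m) (xs ++ block κ m ++ ys)    ≡⟨ cong (filter (_<? m)) eq ⟩
        filter (_<? m) (xs′ ++ block κ m ++ ys′)  ≡⟨ filter-insert xs′ ys′ (All.lookup W<m π′∈) ⟩
        xs′ ++ ys′                                ∎)
      where open ≡-Reasoning

-- The multisets and the enumeration of their permutations

barred-suc : ∀ n → barred (suc n) ≡ suc (2 ℕ.* n)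
barred-suc n = cong ℕ.pred (ℕ.*-suc 2 n)

barred-fits : ∀ n → Fits bar (barred (suc n))
barred-fits n = cong (ℕ._≡ᵇ 0)
  (trans (cong (ℕ._% 2) (trans (barred-suc n) (cong suc (ℕ.*-comm 2 n)))) ([m+kn]%n≡m%n 1 n 2))

unbarred-fits : ∀ n → Fits pair (unbarred n)
unbarred-fits n = cong (ℕ._≡ᵇ 0) (trans (cong (ℕ._% 2) (ℕ.*-comm 2 n)) (m*n%n≡0 n 2))

barred<unbarred : ∀ n → barred (suc n) < unbarred (suc n)
barred<unbarred n = ℕ.≤-refl

M≤ : ∀ n → All (_≤ 2 ℕ.* n) (M n)
M≤ zero    = []
M≤ (suc n) = All.++⁺ (All.map (λ x≤ → ℕ.≤-trans x≤ (ℕ.*-monoʳ-≤ 2 (ℕ.n≤1+n n))) (M≤ n))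
                     (ℕ.<⇒≤ (barred<unbarred n) ∷ ℕ.≤-refl ∷ ℕ.≤-refl ∷ [])

M<barred : ∀ n → All (_< barred (suc n)) (M n)
M<barred n rewrite barred-suc n = All.map s≤s (M≤ n)

MD<unbarred : ∀ n → All (_< unbarred (suc n)) (MD (suc n))
MD<unbarred n = All.++⁺ (All.map (λ x< → ℕ.<-trans x< (barred<unbarred n)) (M<barred n))
                        (barred<unbarred n ∷ [])

0<barred : ∀ n → 0 < barred (suc n)
0<barred n rewrite barred-suc n = s≤s z≤n

length-M : ∀ n → length (M n) ≡ 3 ℕ.* n
length-M zero    = refl
length-M (suc n) rewrite length-++ (M n) {barred (suc n) ∷ unbarred (suc n) ∷ unbarred (suc n) ∷ []} | length-M n =
  trans (ℕ.+-comm (3 ℕ.* n) 3) (sym (ℕ.*-suc 3 n))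

length-MD : ∀ n → length (MD (suc n)) ≡ suc (3 ℕ.* n)
length-MD n rewrite length-++ (M n) {barred (suc n) ∷ []} | length-M n = ℕ.+-comm (3 ℕ.* n) 1

MD↭ : ∀ n → MD (suc n) ↭ block bar (barred (suc n)) ++ M n
MD↭ n = ↭-++-comm (M n) _

M↭ : ∀ n → M (suc n) ↭ block pair (unbarred (suc n)) ++ MD (suc n)
M↭ n = ↭-trans (↭-reflexive (sym (++-assoc (M n) (barred (suc n) ∷ []) (unbarred (suc n) ∷ unbarred (suc n) ∷ []))))
               (↭-++-comm (MD (suc n)) _)

-- WD n enumerates JSPD (suc n).
WJ WD : ℕ → List (List ℕ)
WJ zero    = [] ∷ []
WJ (suc n) = extend pair (unbarred (suc n)) (WD n)
WD n       = extend bar (barred (suc n)) (WJ n)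

WJ-enum : ∀ n → Enumerates (WJ n) (M n)
WD-enum : ∀ n → Enumerates (WD n) (MD (suc n))
WJ-enum zero π = mk⇔ (λ { (here refl) → ↭-refl , tt }) (λ (π↭ , _) → here (↭-empty-inv π↭))
WJ-enum (suc n) = extend-Enumerates pair (unbarred-fits (suc n)) (MD<unbarred n) (M↭ n) (WD-enum n)
WD-enum n = extend-Enumerates bar (barred-fits n) (M<barred n) (MD↭ n) (WJ-enum n)

Enumerates-All : ∀ {W R} {Q : ℕ → Set} → Enumerates W R → All Q R → All (All Q) W
Enumerates-All enum qs = All.tabulate λ {π} π∈ → All-resp-↭ (↭-sym (proj₁ (Equivalence.to (enum π) π∈))) qs

WJ-unique : ∀ n → Unique (WJ n)
WD-unique : ∀ n → Unique (WD n)
WJ-unique zero    = [] ∷ []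
WJ-unique (suc n) = extend-unique pair (Enumerates-All (WD-enum n) (MD<unbarred n)) (WD-unique n)
WD-unique n = extend-unique bar (Enumerates-All (WJ-enum n) (M<barred n)) (WJ-unique n)

-- Generating functions and the recurrences

typesOf : List ℕ → List Type
typesOf π = types (0 ∷ π ++ [ 0 ])

F : List (List ℕ) → Weight → ℤ
F W f = ∑ W (λ π → ev (typesOf π) f)

F-cong : ∀ W {f g : Weight} → (∀ u e k a → f u e k a ≡ g u e k a) → F W f ≡ F W g
F-cong W eq = ∑-cong W (λ _ → eq _ _ _ _)

-- The empty word is left out: its only gap lies between two zeros and belongs to no letter. The
-- induction therefore starts at the one-letter word.
data Regular : List ℕ → Set where
  regular : ∀ {x l} → 0 < x → Locals (0 ∷ x ∷ l ++ [ 0 ]) → Regular (x ∷ l)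

F-extend : ∀ κ {m} W f → Fits κ m → (∀ {π} → π ∈ W → Regular π × All (_< m) π) →
           F (extend κ m W) f ≡ F W (D (β κ f))
F-extend κ {m} W f fits reg = trans (∑-concatMap (inserts (block κ m)) _ W) (∑-cong W each)
  where
  each : ∀ {π} → π ∈ W → ∑ (inserts (block κ m) π) (λ ρ → ev (typesOf ρ) f) ≡ ev (typesOf π) (D (β κ f))
  each π∈ with reg π∈
  ... | regular {x} {l} 0<x locs , π<m =
    trans (Insertion.inserts-sum κ m fits l f locs 0<x π<m) (dv≡ev-D (typesOf (x ∷ l)) (β κ f))

β₃ : Kind → Weight₃ → Weight₃
β₃ bar  g u e m = g u (suc e) m
β₃ pair g u e m = g (suc u) (suc e) m

β-res : ∀ κ g u e k a → β κ (res g) u e k a ≡ res (β₃ κ g) u e k a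
β-res bar  g u e zero    a = refl
β-res bar  g u e (suc k) a = refl
β-res pair g u e zero    a = refl
β-res pair g u e (suc k) a = refl

P-β : ∀ κ f u e m → P (β κ f) u e m ≡ β₃ κ (P f) u e m
P-β bar  f u e zero    = refl
P-β pair f u e zero    = refl
P-β bar  f u e (suc m) = cong₂ _+_ (P-β bar (sh K f) u e m) (P-β bar (sh A f) u e m)
P-β pair f u e (suc m) = cong₂ _+_ (P-β pair (sh K f) u e m) (P-β pair (sh A f) u e m)

-- The words of W come in groups of 2ᵐ in which each of m letters is independently of type K or A;
-- such a group contains exactly one word without letters of type K.
Balanced : List (List ℕ) → Set
Balanced W = ∀ f → F W f ≡ F W (res (P f))

module _ (κ : Kind) {m : ℕ} {W : List (List ℕ)} (fits : Fits κ m)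
         (reg : ∀ {π} → π ∈ W → Regular π × All (_< m) π) (bal : Balanced W) where

  -- Words of W with one letter of type K also contribute, since an insertion can turn that letter
  -- into type Z. Balance trades them for words without K, so the recursion closes on the latter.
  F-extend-res : ∀ g → F (extend κ m W) (res g) ≡ F W (res (D₃ (β₃ κ g)))
  F-extend-res g = begin
    F (extend κ m W) (res g)           ≡⟨ F-extend κ W (res g) fits reg ⟩
    F W (D (β κ (res g)))              ≡⟨ bal _ ⟩
    F W (res (P (D (β κ (res g)))))    ≡⟨ F-cong W (res-cong λ u e m → trans (P-D (β κ (res g)) u e m) (D₃-cong P-β-res u e m)) ⟩
    F W (res (D₃ (β₃ κ g)))            ∎
    where
    open ≡-Reasoning
    P-β-res : ∀ u e m → P (β κ (res g)) u e m ≡ β₃ κ g u e m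
    P-β-res u e m = trans (P-cong (β-res κ g) u e m) (P-res (β₃ κ g) u e m)

  -- `P` intertwines `D` with `D₃` and `β` with `β₃`, so both sides reduce to the same sum over W.
  Balanced-extend : Balanced (extend κ m W)
  Balanced-extend f = begin
    F (extend κ m W) f               ≡⟨ F-extend κ W f fits reg ⟩
    F W (D (β κ f))                  ≡⟨ bal _ ⟩
    F W (res (P (D (β κ f))))        ≡⟨ F-cong W (res-cong λ u e m → trans (P-D (β κ f) u e m) (D₃-cong (P-β κ f) u e m)) ⟩
    F W (res (D₃ (β₃ κ (P f))))      ≡⟨ F-extend-res (P f) ⟨
    F (extend κ m W) (res (P f))     ∎
    where open ≡-Reasoning

  Regular-extend : 0 < m → ∀ {ρ} → ρ ∈ extend κ m W → Regular ρ
  Regular-extend 0<m ρ∈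
    with π , π∈ , ρ∈π ← find (∈-concatMap⁻ (inserts (block κ m)) {W} ρ∈)
    with reg π∈
  ... | regular {x} {l} 0<x locs , π<m = go ρ∈π (Locals-inserts₀ κ fits π<m locs ρ∈π)
    where
    head-block : ∀ κ {l} → Locals (0 ∷ (block κ m ++ l) ++ [ 0 ]) → Regular (block κ m ++ l)
    head-block bar  = regular 0<m
    head-block pair = regular 0<m
    go : ∀ {ρ} → ρ ∈ inserts (block κ m) (x ∷ l) → Locals (0 ∷ ρ ++ [ 0 ]) → Regular ρ
    go (here refl) = head-block κ
    go (there p) locs with _ , _ , refl ← ∈-map⁻ (x ∷_) p = regular 0<x locs

degree-regular : ∀ {π} → Regular π → degree (typesOf π) ≡ suc (length π)
degree-regular (regular {x} {l} 0<x _) =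
  trans (degree-types 0 x l) (cong (ℕ._+ suc (length l)) (cong toℕ (<⇒<ᵇ≡true 0<x)))

-- Extraction of coefficients

ind : ℤ → ℕ → ℤ
ind i n with + n ℤ.≟ i
... | yes _ = + 1
... | no  _ = + 0

-- Turns factors that depend on the word into the coefficients of the recurrences.
ind-scale : ∀ i n → + n * ind i n ≡ i * ind i n
ind-scale i n with + n ℤ.≟ i
... | yes p = cong (λ z → z * + 1) p
... | no  _ = trans (ℤ.*-zeroʳ (+ n)) (sym (ℤ.*-zeroʳ i))

ind-cong : ∀ i n i′ n′ → (+ n ≡ i → + n′ ≡ i′) → (+ n′ ≡ i′ → + n ≡ i) → ind i n ≡ ind i′ n′
ind-cong i n i′ n′ to from with + n ℤ.≟ i | + n′ ℤ.≟ i′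
... | yes _ | yes _ = refl
... | no  _ | no  _ = refl
... | yes p | no ¬q = contradiction (to p) ¬q
... | no ¬p | yes q = contradiction (from q) ¬p

private
  pred-eq : ∀ i n → + suc n ≡ i → + n ≡ i - + 1
  pred-eq _ n refl = refl
  suc-eq : ∀ i → i ≡ + 1 + (i - + 1)
  suc-eq = solve-∀
  suc-eq′ : ∀ i → i ≡ i + + 1 - + 1
  suc-eq′ = solve-∀

ind-suc : ∀ i n → ind i (suc n) ≡ ind (i - + 1) n
ind-suc i n = ind-cong i (suc n) (i - + 1) n (pred-eq i n)
  (λ eq → trans (cong (λ z → + 1 + z) eq) (sym (suc-eq i)))

ind-suc′ : ∀ i n → ind i n ≡ ind (i + + 1) (suc n)
ind-suc′ i n = trans (cong (λ z → ind z n) (suc-eq′ i)) (sym (ind-suc (i + + 1) n))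

-- `m` can be ignored because u, e and the degree determine it.
at : ℤ → ℤ → Weight₃
at i j u e m = ind i u * ind j e

∂-const : ∀ (c : ℤ) n → ∂ (λ _ → c) n ≡ + n * c
∂-const c zero    = refl
∂-const c (suc n) = refl

private
  expand : ∀ G u e p q r s →
    e * (p * q) + (G - u - + 2 * e) * (p * s + p * s) + u * (r * s)
    ≡ (e * q) * p + + 2 * ((G * p - u * p) * s - + 2 * (p * (e * s))) + (u * r) * s
  expand = solve-∀

  collect : ∀ G i j i′ j′ p q r s →
    (j * q) * p + + 2 * ((G * p - i′ * p) * s - + 2 * (p * (j′ * s))) + (i * r) * s
    ≡ i * (r * s) + j * (p * q) + + 2 * (G - i′ - + 2 * j′) * (p * s)
  collect = solve-∀

-- The gap count gives m = G - u - 2e, and `ind-scale` then replaces exponents by indices.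
-- Independent i, i′ and j, j′ let this serve both kinds of block.
D₃-indicator : ∀ {G} u e m i i′ j j′ →
  let p = ind i′ u ; q = ind j e ; r = ind i u ; s = ind j′ e in
  u ℕ.+ 2 ℕ.* e ℕ.+ m ≡ G →
  + e * (p * q) + + m * (p * s + p * s) + + u * (r * s)
  ≡ i * (r * s) + j * (p * q) + + 2 * (+ G - i′ - + 2 * j′) * (p * s)
D₃-indicator {G} u e m i i′ j j′ deg = begin
  + e * (p * q) + + m * (p * q′ + p * q′) + + u * (r * q′)
    ≡⟨ cong (λ z → + e * (p * q) + z * (p * q′ + p * q′) + + u * (r * q′)) m≡ ⟩
  + e * (p * q) + (+ G - + u - + 2 * + e) * (p * q′ + p * q′) + + u * (r * q′)
    ≡⟨ expand (+ G) (+ u) (+ e) p q r q′ ⟩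
  (+ e * q) * p + + 2 * ((+ G * p - + u * p) * q′ - + 2 * (p * (+ e * q′))) + (+ u * r) * q′
    ≡⟨ cong₂ _+_ (cong₂ (λ y z → y * p + + 2 * z) (ind-scale j e)
                   (cong₂ (λ y z → (+ G * p - y) * q′ - + 2 * (p * z)) (ind-scale i′ u) (ind-scale j′ e)))
                 (cong (λ z → z * q′) (ind-scale i u)) ⟩
  (j * q) * p + + 2 * ((+ G * p - i′ * p) * q′ - + 2 * (p * (j′ * q′))) + (i * r) * q′
    ≡⟨ collect (+ G) i j i′ j′ p q r q′ ⟩
  i * (r * q′) + j * (p * q) + + 2 * (+ G - i′ - + 2 * j′) * (p * q′) ∎
  where
  open ≡-Reasoning
  p = ind i′ u
  q = ind j e
  r = ind i u
  q′ = ind j′ e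
  cancel : ∀ m u e → m ≡ u + e + m - u - e
  cancel = solve-∀
  m≡ : + m ≡ + G - + u - + 2 * + e
  m≡ = begin
    + m                                     ≡⟨ cancel (+ m) (+ u) (+ (2 ℕ.* e)) ⟩
    + (u ℕ.+ 2 ℕ.* e ℕ.+ m) - + u - + (2 ℕ.* e) ≡⟨ cong₂ (λ g z → + g - + u - z) deg (ℤ.pos-* 2 e) ⟩
    + G - + u - + 2 * + e                   ∎

D₃-pair : ∀ {u e m G} i j → u ℕ.+ 2 ℕ.* e ℕ.+ m ≡ G →
  D₃ (β₃ pair (at i j)) u e m ≡
  i * at i (j - + 1) u e m + j * at (i - + 1) j u e m
  + + 2 * (+ G - (i - + 1) - + 2 * (j - + 1)) * at (i - + 1) (j - + 1) u e m
D₃-pair {u} {e} {m} {G} i j deg = begin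
  D₃ (β₃ pair (at i j)) u e m
    ≡⟨ cong₂ _+_ (cong₂ _+_ (∂-∘suc (λ e′ → ind i (suc u) * ind j e′) e) (∂-const c m))
                 (∂-∘suc (λ u′ → ind i u′ * ind j (suc e)) u) ⟩
  + e * (ind i (suc u) * ind j e) + + m * c + + u * (ind i u * ind j (suc e))
    ≡⟨ cong₂ (λ p s → + e * (p * ind j e) + + m * (p * s + p * s) + + u * (ind i u * s)) (ind-suc i u) (ind-suc j e) ⟩
  + e * (p * q) + + m * (p * s′ + p * s′) + + u * (r * s′)
    ≡⟨ D₃-indicator u e m i (i - + 1) j (j - + 1) deg ⟩
  i * (r * s′) + j * (p * q) + + 2 * (+ G - (i - + 1) - + 2 * (j - + 1)) * (p * s′) ∎
  where
  open ≡-Reasoning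
  c = ind i (suc u) * ind j (suc e) + ind i (suc u) * ind j (suc e)
  p = ind (i - + 1) u
  q = ind j e
  r = ind i u
  s′ = ind (j - + 1) e

D₃-bar : ∀ {u e m G} i j → u ℕ.+ 2 ℕ.* e ℕ.+ m ≡ G →
  D₃ (β₃ bar (at i j)) u e m ≡
  (i + + 1) * at (i + + 1) (j - + 1) u e m + j * at i j u e m
  + + 2 * (+ G - i - + 2 * (j - + 1)) * at i (j - + 1) u e m
D₃-bar {u} {e} {m} {G} i j deg = begin
  D₃ (β₃ bar (at i j)) u e m
    ≡⟨ cong₂ _+_ (cong₂ _+_ (∂-∘suc (λ e′ → ind i u * ind j e′) e) (∂-const c m))
                 -- A bar adds no U, so if the insertion destroys one, the word had i + 1 of them
                 -- before.
                 (trans (∂-cong (λ u′ → cong (λ z → z * ind j (suc e)) (ind-suc′ i u′)) u)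
                        (∂-∘suc (λ u′ → ind (i + + 1) u′ * ind j (suc e)) u)) ⟩
  + e * (ind i u * ind j e) + + m * c + + u * (ind (i + + 1) u * ind j (suc e))
    ≡⟨ cong (λ s → + e * (p * ind j e) + + m * (p * s + p * s) + + u * (r * s)) (ind-suc j e) ⟩
  + e * (p * q) + + m * (p * s′ + p * s′) + + u * (r * s′)
    ≡⟨ D₃-indicator u e m (i + + 1) i j (j - + 1) deg ⟩
  (i + + 1) * (r * s′) + j * (p * q) + + 2 * (+ G - i - + 2 * (j - + 1)) * (p * s′) ∎
  where
  open ≡-Reasoning
  c = ind i u * ind j (suc e) + ind i u * ind j (suc e)
  p = ind i u
  q = ind j e
  r = ind (i + + 1) u
  s′ = ind (j - + 1) e

private
  zeros : ∀ p q r → + 0 ≡ p * + 0 + q * + 0 + r * + 0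
  zeros = solve-∀

∑-linear : ∀ {X : Set} (W : List X) p q r (f g h : X → ℤ) →
           ∑ W (λ π → p * f π + q * g π + r * h π) ≡ p * ∑ W f + q * ∑ W g + r * ∑ W h
∑-linear [] p q r f g h = zeros p q r
∑-linear (π ∷ W) p q r f g h =
  trans (cong (λ z → p * f π + q * g π + r * h π + z) (∑-linear W p q r f g h))
        (distribute p q r (f π) (g π) (h π) (∑ W f) (∑ W g) (∑ W h))
  where
  distribute : ∀ p q r x y z x′ y′ z′ →
    p * x + q * y + r * z + (p * x′ + q * y′ + r * z′) ≡ p * (x + x′) + q * (y + y′) + r * (z + z′)
  distribute = solve-∀

-- All words of W share one degree, so the pointwise identity is required only there.
F-res-linear : ∀ {W G k} p q r (f g h : Weight₃) → (∀ {π} → π ∈ W → degree (typesOf π) ≡ G) →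
  (∀ u e m → u ℕ.+ 2 ℕ.* e ℕ.+ m ≡ G → k u e m ≡ p * f u e m + q * g u e m + r * h u e m) →
  F W (res k) ≡ p * F W (res f) + q * F W (res g) + r * F W (res h)
F-res-linear {W} {G} {k} p q r f g h deg eq =
  trans (∑-cong W (λ {π} π∈ → let ts = typesOf π in pointwise (# U ts) (# E ts) (# K ts) (# A ts) (deg π∈)))
        (∑-linear W p q r (λ π → ev (typesOf π) (res f)) (λ π → ev (typesOf π) (res g)) (λ π → ev (typesOf π) (res h)))
  where
  pointwise : ∀ u e k′ a → u ℕ.+ 2 ℕ.* e ℕ.+ k′ ℕ.+ a ≡ G →
              res k u e k′ a ≡ p * res f u e k′ a + q * res g u e k′ a + r * res h u e k′ a
  pointwise u e zero    a d = eq u e a (trans (cong (ℕ._+ a) (sym (ℕ.+-identityʳ (u ℕ.+ 2 ℕ.* e)))) d)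
  pointwise u e (suc _) a d = zeros p q r

Good : List (List ℕ) → Set
Good W = (∀ {π} → π ∈ W → Regular π) × Balanced W

below : ∀ {m W R} → Enumerates W R → All (_< m) R → ∀ {π} → π ∈ W → All (_< m) π
below enum R<m = All.lookup (Enumerates-All enum R<m)

Good-extend : ∀ κ {m W R} → Fits κ m → 0 < m → Enumerates W R → All (_< m) R → Good W → Good (extend κ m W)
Good-extend κ fits 0<m enum R<m (reg , bal) =
  Regular-extend κ fits bounds bal 0<m , Balanced-extend κ fits bounds bal
  where bounds = λ {π} π∈ → reg {π} π∈ , below enum R<m π∈

WJ-good : ∀ n → Good (WJ (suc n))
WD-good : ∀ n → Good (WD n)
WJ-good n = Good-extend pair (unbarred-fits (suc n)) (s≤s z≤n) (WD-enum n) (MD<unbarred n) (WD-good n)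
WD-good (suc n) = Good-extend bar (barred-fits (suc n)) (0<barred (suc n)) (WJ-enum (suc n)) (M<barred (suc n)) (WJ-good n)
-- The single letter has type E, so no K or A occurs and balance is trivial.
WD-good zero = (λ { (here refl) → regular (s≤s z≤n) (record
  { peak⇒barred = λ _ _ → refl ; barred⇒single = λ _ () ; no-triple = λ () } ∷ two) }) , λ f → refl

degree-enum : ∀ {W R G} → Good W → Enumerates W R → length R ≡ G → ∀ {π} → π ∈ W → degree (typesOf π) ≡ suc G
degree-enum (reg , _) enum len π∈ =
  trans (degree-regular (reg π∈)) (cong suc (trans (↭-length (proj₁ (Equivalence.to (enum _) π∈))) len))

s≡F : ∀ n i j → s (suc n) i j ≡ F (WJ (suc n)) (res (at i j))
t≡F : ∀ n i j → t (suc n) i j ≡ F (WD n) (res (at i j))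
s≡F n i j = begin
  s (suc n) i j
    ≡⟨ cong₂ _+_ (cong₂ _+_ (cong (λ x → i * x) (t≡F n i (j - + 1))) (cong (λ x → j * x) (t≡F n (i - + 1) j)))
                 (cong₂ (λ c x → + 2 * c * x) coefficient (t≡F n (i - + 1) (j - + 1))) ⟩
  i * F (WD n) (res (at i (j - + 1))) + j * F (WD n) (res (at (i - + 1) j))
    + + 2 * c * F (WD n) (res (at (i - + 1) (j - + 1)))
    ≡⟨ F-res-linear i j (+ 2 * c) (at i (j - + 1)) (at (i - + 1) j) (at (i - + 1) (j - + 1))
         (degree-enum (WD-good n) (WD-enum n) (length-MD n)) (λ u e m → D₃-pair {u} {e} {m} i j) ⟨
  F (WD n) (res (D₃ (β₃ pair (at i j))))
    ≡⟨ F-extend-res pair (unbarred-fits (suc n)) (λ {π} π∈ → reg π∈ , below (WD-enum n) (MD<unbarred n) π∈) bal (at i j) ⟨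
  F (WJ (suc n)) (res (at i j)) ∎
  where
  open ≡-Reasoning
  -- `MD (suc n)` has 3n + 1 letters, hence 3n + 2 gaps; both indices drop by one because a pair
  -- adds a U and an E.
  c = + (2 ℕ.+ 3 ℕ.* n) - (i - + 1) - + 2 * (j - + 1)
  reg = λ {π} → proj₁ (WD-good n) {π}
  bal = proj₂ (WD-good n)
  shift-index : ∀ x i j → + 3 + x + + 2 - i - + 2 * j ≡ + 2 + x - (i - + 1) - + 2 * (j - + 1)
  shift-index = solve-∀
  coefficient : + (3 ℕ.* suc n ℕ.+ 2) - i - + 2 * j ≡ c
  coefficient = trans (cong (λ x → + (x ℕ.+ 2) - i - + 2 * j) (ℕ.*-suc 3 n)) (shift-index (+ (3 ℕ.* n)) i j)
t≡F (suc n) i j = begin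
  t (suc (suc n)) i j
    ≡⟨ cong₂ _+_ (cong₂ _+_ (cong (λ x → (i + + 1) * x) (s≡F n (i + + 1) (j - + 1))) (cong (λ x → j * x) (s≡F n i j)))
                 (cong₂ (λ c x → + 2 * c * x) (shift-index (+ (3 ℕ.* suc n)) i j) (s≡F n i (j - + 1))) ⟩
  (i + + 1) * F (WJ (suc n)) (res (at (i + + 1) (j - + 1))) + j * F (WJ (suc n)) (res (at i j))
    + + 2 * c * F (WJ (suc n)) (res (at i (j - + 1)))
    ≡⟨ F-res-linear (i + + 1) j (+ 2 * c) (at (i + + 1) (j - + 1)) (at i j) (at i (j - + 1))
         (degree-enum (WJ-good n) (WJ-enum (suc n)) (length-M (suc n))) (λ u e m → D₃-bar {u} {e} {m} i j) ⟨
  F (WJ (suc n)) (res (D₃ (β₃ bar (at i j))))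
    ≡⟨ F-extend-res bar (barred-fits (suc n)) (λ {π} π∈ → reg π∈ , below (WJ-enum (suc n)) (M<barred (suc n)) π∈) bal (at i j) ⟨
  F (WD (suc n)) (res (at i j)) ∎
  where
  open ≡-Reasoning
  -- `M (suc n)` has 3(n + 1) letters and one more gap; only j drops, since a bar adds just an E.
  c = + (1 ℕ.+ 3 ℕ.* suc n) - i - + 2 * (j - + 1)
  reg = λ {π} → proj₁ (WJ-good n) {π}
  bal = proj₂ (WJ-good n)
  shift-index : ∀ x i j → x + + 3 - i - + 2 * j ≡ + 1 + x - i - + 2 * (j - + 1)
  shift-index = solve-∀
t≡F zero (+ zero)  (+ zero)        = refl
t≡F zero (+ zero)  (+ suc zero)    = refl
t≡F zero (+ zero)  (+ suc (suc _)) = refl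
t≡F zero (+ zero)  (-[1+ _ ])      = refl
t≡F zero (+ suc _) _               = refl
t≡F zero (-[1+ _ ]) _              = refl

-- From generating functions to cardinalities

∑-filter : ∀ {X : Set} {Q : X → Set} (Q? : ∀ x → Dec (Q x)) (f : X → ℤ) (W : List X) →
           (∀ {x} → x ∈ W → Q x → f x ≡ + 1) → (∀ {x} → x ∈ W → ¬ Q x → f x ≡ + 0) →
           ∑ W f ≡ + length (filter Q? W)
∑-filter Q? f []      is1 is0 = refl
∑-filter Q? f (x ∷ W) is1 is0 with Q? x
... | yes q = cong₂ _+_ (is1 (here refl) q) (∑-filter Q? f W (λ x∈ → is1 (there x∈)) (λ x∈ → is0 (there x∈)))
... | no ¬q = trans (cong₂ _+_ (is0 (here refl) ¬q) (∑-filter Q? f W (λ x∈ → is1 (there x∈)) (λ x∈ → is0 (there x∈))))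
                    (ℤ.+-identityˡ _)

module _ (i j : ℤ) where

  HasStats : List ℕ → Set
  HasStats π = + ubdes π ≡ i × + expk π ≡ j × bddes π ≡ 0 × desp π ≡ 0

  hasStats? : ∀ π → Dec (HasStats π)
  hasStats? π = (+ ubdes π ℤ.≟ i) ×-dec (+ expk π ℤ.≟ j) ×-dec (bddes π ℕ.≟ 0) ×-dec (desp π ℕ.≟ 0)

  res-at-one : ∀ {u e b c} a → + u ≡ i → + e ≡ j → b ≡ 0 → c ≡ 0 → res (at i j) u e (b ℕ.+ c) a ≡ + 1
  res-at-one {u} {e} a p q refl refl with + u ℤ.≟ i | + e ℤ.≟ j
  ... | yes _ | yes _ = refl
  ... | no ¬p | _     = contradiction p ¬p
  ... | yes _ | no ¬q = contradiction q ¬q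

  -- The exponent of K is `bddes` plus `desp`, which is zero only if both are, so K = 0 imposes both
  -- conditions.
  res-at-zero : ∀ {u e b c} a → ¬ (+ u ≡ i × + e ≡ j × b ≡ 0 × c ≡ 0) → res (at i j) u e (b ℕ.+ c) a ≡ + 0
  res-at-zero {b = suc _}             a ¬r = refl
  res-at-zero {b = zero} {c = suc _}  a ¬r = refl
  res-at-zero {u} {e} {zero} {zero}   a ¬r with + u ℤ.≟ i | + e ℤ.≟ j
  ... | yes p | yes q = contradiction (p , q , refl , refl) ¬r
  ... | no _  | yes _ = refl
  ... | no _  | no _  = refl
  ... | yes _ | no _  = refl

  ev-stats : ∀ {π} → Regular π →
             ev (typesOf π) (res (at i j)) ≡ res (at i j) (ubdes π) (expk π) (bddes π ℕ.+ desp π) (# A (typesOf π))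
  ev-stats {π} (regular _ locs) with p , q , r ← #-types locs
    rewrite p | q | r = refl

  solution : ∀ {W R} → Unique W → Enumerates W R → (∀ {π} → π ∈ W → Regular π) → ∀ {x} → x ≡ F W (res (at i j)) →
    Σ (List (List ℕ)) λ L → Unique L
      × ((π : List ℕ) → (π ∈ L) ⇔ ((π ↭ R × JSCond π) × HasStats π))
      × x ≡ + length L
  solution {W} {R} W! enum reg x≡ =
    filter hasStats? W , Unique.filter⁺ hasStats? W! , members ,
    trans x≡ (∑-filter hasStats? _ W
      (λ {π} π∈ (p , q , r , v) → trans (ev-stats (reg π∈)) (res-at-one (# A (typesOf π)) p q r v))
      (λ {π} π∈ ¬stats → trans (ev-stats (reg π∈)) (res-at-zero (# A (typesOf π)) ¬stats)))
    where
    members : (π : List ℕ) → (π ∈ filter hasStats? W) ⇔ ((π ↭ R × JSCond π) × HasStats π)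
    members π = mk⇔
      (λ π∈ → let π∈W , stats = ∈-filter⁻ hasStats? {xs = W} π∈
                  π↭ , js = Equivalence.to (enum π) π∈W
              in (π↭ , JS⇒JSCond π js) , stats)
      (λ ((π↭ , js) , stats) → ∈-filter⁺ hasStats? (Equivalence.from (enum π) (π↭ , JSCond⇒JS π js)) stats)

theorem16 : (n : ℕ) → 1 ≤ n → (i j : ℤ) →
    (Σ (List (List ℕ)) λ L → Unique L
    × ((π : List ℕ) → (π ∈ L) ⇔ (JSP n π × + ubdes π ≡ i × + expk π ≡ j × bddes π ≡ 0 × desp π ≡ 0))
    × s n i j ≡ + length L)
    × (Σ (List (List ℕ)) λ L → Unique L
    × ((π : List ℕ) → (π ∈ L) ⇔ (JSPD n π × + ubdes π ≡ i × + expk π ≡ j × bddes π ≡ 0 × desp π ≡ 0))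
    × t n i j ≡ + length L)
theorem16 (suc n) _ i j =
  solution i j (WJ-unique (suc n)) (WJ-enum (suc n)) (proj₁ (WJ-good n)) (s≡F n i j) ,
  solution i j (WD-unique n) (WD-enum n) (proj₁ (WD-good n)) (t≡F n i j)
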